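{- There exists a class $\mathcal{F}$ of boolean functions of unbounded arity such that every function $f \in \mathcal{F}$ of arity $n$ has $\mathcal{SDD}_c$ size in $O(n^3)$ and $\mathcal{OBDD}$ size in $2^{\Omega(n)}$.
   Context: Circuits are NNFs: boolean circuits (DAGs with a single output gate) whose input gates are labelled by constants $\bot,\top$ or by literals $x,\neg x$ on variables, and whose internal gates are unbounded-fanin $\vee$- and $\wedge$-gates. The size of a circuit is the number of arcs of its DAG. For a gate $g$, $C_g$ denotes the subcircuit with output $g$ (all gates with a directed path to $g$). For a class $\mathcal{L}$ of circuits and a boolean function $f$, the $\mathcal{L}$ size of $f$ is $\mathcal{L}(f)=\min\{\mathrm{size}(C): C\in\mathcal{L}, C \text{ computes } f\}$. A vtree for a finite nonempty variable set $Y$ is a rooted, full, ordered binary tree whose leaves are identified bijectively with $Y$; for an internal node $v$, $v_l,v_r$ are its left and right children, $T_v$ the subtree rooted at $v$, and $Y_v$ the set of leaves of $T_v$. An SDD respecting a vtree $T$ is defined inductively: (i) a single gate labelled by a literal on a variable $x$ that is a leaf of $T$; (ii) a single gate labelled by a constant (any $T$); (iii) a circuit $C=\bigvee_{i=1}^m (C_{p_i}\wedge C_{s_i})$ with $m\ge 2$ (an output $\vee$-gate with wires from $m$ $\wedge$-gates, the $i$-th having wires from gates $p_i,s_i$) such that for some internal node $v$ of $T$ and all $i$: $C_{p_i}$ is an SDD respecting a subtree of $T_{v_l}$; $C_{s_i}$ is an SDD respecting a subtree of $T_{v_r}$; and, viewed as functions on $Y_{v_l}$, $C_{p_i}\not\equiv\bot$,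 $C_{p_i}\wedge C_{p_j}\equiv\bot$ for $i<j$, and $\bigvee_i C_{p_i}\equiv\top$. An SDD is an SDD respecting some vtree. It is compressed if at every $\vee$-gate of the form in (iii) (relative to node $v$), the subs are pairwise nonequivalent as functions on $Y_{v_r}$: $C_{s_i}\not\equiv C_{s_j}$ for $i<j$. $\mathcal{SDD}_c$ is the class of compressed SDDs. A vtree is right-linear if every left child is a leaf. $\mathcal{OBDD}$ is the class of compressed SDDs respecting some right-linear vtree (these are exactly reduced ordered binary decision diagrams). -}

module Defs where

open import Data.Nat using (ℕ; zero; suc; _+_; _*_; _^_; _≤_)
open import Data.Fin using (Fin; fromℕ) renaming (_<_ to _<ᶠ_)
open import Data.Bool using (Bool; true; false; not; if_then_else_)
open import Data.List using (List; []; _∷_; length; lookup; map; allFin)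
open import Data.Nat.ListAction using (sum)
open import Data.List.Membership.Propositional using (_∈_)
open import Data.List.Relation.Unary.Unique.Propositional using (Unique)
open import Data.List.Relation.Binary.Pointwise using (Pointwise)
open import Data.Product using (Σ; ∃; _×_; _,_; proj₁; proj₂)
open import Data.Empty using (⊥)
open import Data.Unit using (⊤)
open import Relation.Binary.PropositionalEquality using (_≡_; _≢_)
open import Relation.Nullary using (¬_)

Assignment : ℕ → Set
Assignment n = Fin n → Bool

BoolFun : ℕ → Set
BoolFun n = Assignment n → Bool

-- NNF circuits over the variables Fin n.
-- Gate labels: literal (lit x true = x, lit x false = ¬x), constant
-- (const false = ⊥, const true = ⊤), unbounded fan-in ∨ and ∧.

data Label (n : ℕ) : Set where
  lit   : Fin n → Bool → Label n
  const : Bool → Label n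
  ∨g    : Label n
  ∧g    : Label n

isInput : ∀ {n} → Label n → Bool
isInput (lit _ _) = true
isInput (const _) = true
isInput ∨g        = false
isInput ∧g        = false

-- A circuit is a DAG on the gates Fin (suc m) (topologically ordered:
-- every wire goes from a smaller to a larger index), without parallel
-- arcs, whose input gates have no incoming wires, and with a single
-- output gate (the sink), which is the last gate  fromℕ m : every other
-- gate has a wire into some gate.  children g  lists the gates with a
-- wire into g.
record Circuit (n : ℕ) : Set where
  field
    m          : ℕ
    label      : Fin (suc m) → Label n
    children   : Fin (suc m) → List (Fin (suc m))
    acyclic    : ∀ i j → j ∈ children i → j <ᶠ i
    simple     : ∀ i → Unique (children i)
    inputs     : ∀ i → isInput (label i) ≡ true → children i ≡ []
    singleSink : ∀ i → i ≢ fromℕ m → ∃ λ j → i ∈ children j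

  Gate : Set
  Gate = Fin (suc m)

  output : Gate
  output = fromℕ m

open Circuit public

size : ∀ {n} → Circuit n → ℕ
size C = sum (map (λ g → length (children C g)) (allFin (suc (m C))))

-- Semantics: Val C a g b  means gate g evaluates to b under assignment a.
-- (Because the DAG is acyclic this relation is total and functional.)

litVal : Bool → Bool → Bool
litVal p v = if p then v else not v

module _ {n : ℕ} (C : Circuit n) where

  data Val (a : Assignment n) : Gate C → Bool → Set where
    v-lit   : ∀ {g x p} → label C g ≡ lit x p → Val a g (litVal p (a x))
    v-const : ∀ {g b} → label C g ≡ const b → Val a g b
    v-or1   : ∀ {g c} → label C g ≡ ∨g → c ∈ children C g → Val a c true →
              Val a g true
    v-or0   : ∀ {g} → label C g ≡ ∨g →
              (∀ {c} → c ∈ children C g → Val a c false) → Val a g false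
    v-and0  : ∀ {g c} → label C g ≡ ∧g → c ∈ children C g → Val a c false →
              Val a g false
    v-and1  : ∀ {g} → label C g ≡ ∧g →
              (∀ {c} → c ∈ children C g → Val a c true) → Val a g true

Computes : ∀ {n} → Circuit n → BoolFun n → Set
Computes {n} C f = ∀ (a : Assignment n) → Val C a (output C) (f a)

data VTree (n : ℕ) : Set where
  leaf : Fin n → VTree n
  node : VTree n → VTree n → VTree n

leaves : ∀ {n} → VTree n → List (Fin n)
leaves (leaf x)   = x ∷ []
leaves (node l r) = leaves l Data.List.++ leaves r

-- a vtree (for Y = its leaf set): leaves are pairwise distinct
IsVtree : ∀ {n} → VTree n → Set
IsVtree T = Unique (leaves T)

data _⊑_ {n : ℕ} : VTree n → VTree n → Set where
  here  : ∀ {T} → T ⊑ T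
  left  : ∀ {S l r} → S ⊑ l → S ⊑ node l r
  right : ∀ {S l r} → S ⊑ r → S ⊑ node l r

data RightLinear {n : ℕ} : VTree n → Set where
  rl-leaf : ∀ {x} → RightLinear (leaf x)
  rl-node : ∀ {x r} → RightLinear r → RightLinear (node (leaf x) r)

-- SDDs.  SDDAt C cmp T g : the subcircuit C_g is an SDD respecting T;
-- if cmp ≡ true, additionally every decomposition ∨-gate is compressed.
-- In case (iii) the output ∨-gate g has wires exactly from the ∧-gates
-- listed in  ands  (the i-th with wires from exactly pᵢ, sᵢ, listed in
-- ps). Functions of the subcircuits are compared as functions of all n
-- variables (equivalent to the comparison on Y_{v_l}/Y_{v_r}, since those
-- subcircuits only mention variables of Y_{v_l}/Y_{v_r}).

module _ {n : ℕ} (C : Circuit n) where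

  private
    G = Gate C

  AndOf : G → G × G → Set
  AndOf c (p , s) = label C c ≡ ∧g × children C c ≡ p ∷ s ∷ []

  data SDDAt (cmp : Bool) (T : VTree n) : G → Set where
    sdd-lit   : ∀ {g x p} → label C g ≡ lit x p → leaf x ⊑ T → SDDAt cmp T g
    sdd-const : ∀ {g b} → label C g ≡ const b → SDDAt cmp T g
    sdd-dec   : ∀ {g} (l r : VTree n) (ps : List (G × G)) →
      node l r ⊑ T →
      label C g ≡ ∨g →
      Pointwise AndOf (children C g) ps →
      2 ≤ length ps →
      (∀ i → Σ (VTree n) λ T₁ → T₁ ⊑ l × SDDAt cmp T₁ (proj₁ (lookup ps i))) →
      (∀ i → Σ (VTree n) λ T₂ → T₂ ⊑ r × SDDAt cmp T₂ (proj₂ (lookup ps i))) →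
      (∀ i → ∃ λ a → Val C a (proj₁ (lookup ps i)) true) →
      (∀ i j → i <ᶠ j → ∀ a →
         ¬ (Val C a (proj₁ (lookup ps i)) true ×
            Val C a (proj₁ (lookup ps j)) true)) →
      (∀ a → ∃ λ i → Val C a (proj₁ (lookup ps i)) true) →
      (cmp ≡ true → ∀ i j → i <ᶠ j → ∃ λ a → ∃ λ b →
         Val C a (proj₂ (lookup ps i)) b ×
         Val C a (proj₂ (lookup ps j)) (not b)) →
      SDDAt cmp T g

IsSDDc : ∀ {n} → Circuit n → Set
IsSDDc {n} C = Σ (VTree n) λ T → IsVtree T × SDDAt C true T (output C)

IsOBDD : ∀ {n} → Circuit n → Set
IsOBDD {n} C =
  Σ (VTree n) λ T → IsVtree T × RightLinear T × SDDAt C true T (output C)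

SDDcSize≤ : ∀ {n} → BoolFun n → ℕ → Set
SDDcSize≤ {n} f k =
  Σ (Circuit n) λ C → IsSDDc C × Computes C f × size C ≤ k

{-# OPTIONS --safe #-}
module Submission where

-- An address (a one-hot position c and a role bit) selects a function of two
-- blocks of k variables: one block, chosen by the role, holds keys, the other
-- holds data.  The first true key i points to the datum j with i + j + c ≡ -1
-- (mod k), which is compared with a variable y i.  An SDD branches on the
-- address, then on the pair (first true key, its datum), where every prime is a
-- cube, and reaches the literals ± y i; the y's make the subs distinct.  In an
-- OBDD, cut the order where half of the first block is still unread.  Some role
-- then has at least half of its keys unread and half of its data read; averaged
-- over c, at least k / 4 of the unread keys point to data already read, all of
-- which the OBDD has to remember.

open import Defs
open import Data.Nat using (ℕ; zero; suc; _+_; _*_; _∸_; _^_; _≤_; _<_; z≤n; s≤s; _≤?_)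
open import Data.Nat.Properties as ℕₚ using (≤-refl; ≤-trans; ≤-reflexive; +-mono-≤; +-assoc; +-comm)
open import Data.Nat.ListAction using (sum)
open import Data.Nat.Tactic.RingSolver using (solve-∀)
open import Algebra.Properties.CommutativeMonoid.Sum ℕₚ.+-0-commutativeMonoid as Sumₚ using ()
open import Algebra.Properties.Semiring.Sum ℕₚ.+-*-semiring using (*-distribˡ-sum; *-distribʳ-sum)
  renaming (sum to ∑)
open import Data.Fin using (Fin; zero; suc; toℕ; fromℕ; fromℕ<; inject₁; join; splitAt; combine; remQuot; finToFun; funToFin) renaming (_<_ to _<ᶠ_)
open import Data.Fin.Patterns using (0F; 1F; 2F; 3F)
open import Data.Fin.Permutation using (permutation)
open import Data.Fin.Properties as Finₚ using (inject₁-injective; toℕ-injective; toℕ-inject₁; toℕ-fromℕ; toℕ-fromℕ<; toℕ<n; fromℕ≢inject₁; injective⇒≤; splitAt-join; remQuot-combine; combine-remQuot; combine-injectiveʳ; funToFin-finToFin; 2↔Bool; any?)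
open import Data.Fin.Relation.Unary.Top using (view; ‵fromℕ; ‵inject₁; view-fromℕ; view-inject₁)
open import Data.Bool as Bool using (Bool; true; false; not; _∧_; if_then_else_)
open import Data.Bool.Properties using (¬-not; not-¬; not-involutive)
open import Data.Maybe as Maybe using (Maybe; just; nothing)
open import Data.Maybe.Properties using (just-injective)
open import Data.List using (List; []; _∷_; _++_; length; lookup; map; allFin; tabulate; concat; cartesianProduct)
open import Data.List.Properties using (map-tabulate; map-∘; length-map; length-++; length-tabulate; tabulate-cong)
open import Data.List.Membership.Propositional using (_∈_; _∉_)
open import Data.List.Membership.Propositional.Properties using (∈-map⁺; ∈-map⁻; ∈-++⁺ˡ; ∈-++⁺ʳ; ∈-++⁻; ∈-lookup; ∈-allFin; ∈-concat⁺′; ∈-cartesianProduct⁺)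
open import Data.List.Relation.Unary.Any as Any using (Any; here; there)
open import Data.List.Relation.Unary.Any.Properties as Anyₚ using (lookup-index)
open import Data.List.Relation.Unary.All as All using (All; []; _∷_)
open import Data.List.Relation.Unary.AllPairs as AllPairs using (AllPairs; []; _∷_)
open import Data.List.Relation.Unary.AllPairs.Properties as AllPairsₚ using ()
open import Data.List.Relation.Unary.Unique.Propositional using (Unique)
open import Data.List.Relation.Unary.Unique.Propositional.Properties as Uniqueₚ using ()
open import Data.List.Relation.Binary.Pointwise using (Pointwise; []; _∷_; Pointwise-length)
open import Data.Product using (Σ; ∃; _×_; _,_; proj₁; proj₂; uncurry)
open import Data.Sum as Sum using (_⊎_; inj₁; inj₂)
open import Data.Empty using (⊥; ⊥-elim)
open import Data.Unit using (⊤; tt)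
open import Function using (_∘_; id; case_of_; Inverse)
open import Relation.Binary using (tri<; tri≈; tri>)
open import Relation.Binary.PropositionalEquality using (_≡_; _≢_; refl; sym; trans; cong; cong₂; subst; subst₂; module ≡-Reasoning)
open import Relation.Nullary using (¬_; Dec; yes; no; does)
open import Relation.Nullary.Decidable using (dec-true; dec-false; ¬?)

-- Tree-shaped circuits

-- Compression is the obstacle for the upper bound. If the datum itself were the output, the subs at
-- the inner level would be constants, and compression would leave two elements whose primes are the
-- inner function and its negation. Comparing with `y i` gives every outcome (first true key, datum)
-- its own literal, so no elements merge and each prime remains a cube in at most k + 1 variables.
--
-- The obstacle for the lower bound is that the order of an OBDD is arbitrary. The role lets either
-- block supply the keys, and the shifts `c` together meet every pair of a key and a datum, so some
-- address is bad for the given order. The SDD settles the address above both blocks, and one vtree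
-- serves all addresses.
--
-- The size is cubic: 2k + 1 addresses, times 2k + 1 outcomes, times O(k) for a cube. This budget
-- leaves room for circuits without any sharing, which is why trees are enough.
--
-- The exponent comes from k = 4t: half of the keys and half of the data are 2t each, and (2t)(2t) =
-- k t pairs spread over k shifts leave t for one of them. The arity is 4(2 + k) = 16t + 8.

data Tree (n : ℕ) : Set where
  tree : Label n → List (Tree n) → Tree n

arcs  : ∀ {n} → Tree n → ℕ
arcs* : ∀ {n} → List (Tree n) → ℕ
arcs (tree _ ts) = length ts + arcs* ts
arcs* []       = 0
arcs* (t ∷ ts) = arcs t + arcs* ts

arcs*-++ : ∀ {n} (ts us : List (Tree n)) → arcs* (ts ++ us) ≡ arcs* ts + arcs* us
arcs*-++ []       us = refl
arcs*-++ (t ∷ ts) us = trans (cong (arcs t +_) (arcs*-++ ts us)) (sym (+-assoc (arcs t) _ _))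

module _ {n K : ℕ} (lab : Fin K → Label n) (ch : Fin K → List (Fin K)) where

  -- Unfolding of a gate into a tree, over bare tables of labels and children so that it applies to
  -- unfinished circuits too.
  data Rep (g : Fin K) : Tree n → Set where
    rep : ∀ {l ts} → lab g ≡ l → Pointwise Rep (ch g) ts → Rep g (tree l ts)

module _ {n : ℕ} where

  InputsChildless  : Tree n → Set
  InputsChildless* : List (Tree n) → Set
  InputsChildless (tree l ts) = (isInput l ≡ true → ts ≡ []) × InputsChildless* ts
  InputsChildless* []       = ⊤
  InputsChildless* (t ∷ ts) = InputsChildless t × InputsChildless* ts

  sumFin : ∀ {K} → (Fin K → ℕ) → ℕ
  sumFin f = sum (tabulate f)

  sumFin-last : ∀ {K} (f : Fin (suc K) → ℕ) → sumFin f ≡ f (fromℕ K) + sumFin (f ∘ inject₁)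
  sumFin-last {zero}  f = refl
  sumFin-last {suc K} f = begin
    f zero + sumFin (f ∘ suc)                                  ≡⟨ cong (f zero +_) (sumFin-last (f ∘ suc)) ⟩
    f zero + (f (fromℕ (suc K)) + sumFin (f ∘ suc ∘ inject₁))  ≡⟨ sym (+-assoc (f zero) _ _) ⟩
    f zero + f (fromℕ (suc K)) + sumFin (f ∘ suc ∘ inject₁)    ≡⟨ cong (_+ sumFin (f ∘ suc ∘ inject₁)) (+-comm (f zero) _) ⟩
    f (fromℕ (suc K)) + f zero + sumFin (f ∘ suc ∘ inject₁)    ≡⟨ +-assoc (f (fromℕ (suc K))) _ _ ⟩
    f (fromℕ (suc K)) + sumFin (f ∘ inject₁)                   ∎
    where open ≡-Reasoning

  -- A circuit under construction, read as a stack machine: the gates without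
  -- a parent are the roots, and they represent the trees on the stack.
  record Build (ts : List (Tree n)) : Set where
    field
      K        : ℕ
      lab      : Fin K → Label n
      ch       : Fin K → List (Fin K)
      roots    : List (Fin K)
      ordered  : ∀ i j → j ∈ ch i → j <ᶠ i
      noDup    : ∀ i → Unique (ch i)
      sources  : ∀ i → isInput (lab i) ≡ true → ch i ≡ []
      distinct : Unique roots
      used     : ∀ i → i ∈ roots ⊎ ∃ λ j → i ∈ ch j
      reps     : Pointwise (Rep lab ch) roots ts
      total    : sumFin (length ∘ ch) ≡ arcs* ts

  split-Pointwise : ∀ {A B : Set} {R : A → B → Set} {xs} ys {zs} → Pointwise R xs (ys ++ zs) →
    ∃ λ us → ∃ λ vs → xs ≡ us ++ vs × Pointwise R us ys × Pointwise R vs zs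
  split-Pointwise []       ps       = _ , _ , refl , [] , ps
  split-Pointwise (y ∷ ys) (p ∷ ps) with split-Pointwise ys ps
  ... | us , vs , refl , qs , rs = _ , vs , refl , p ∷ qs , rs

  ++-Unique : ∀ {A : Set} (us : List A) {vs} → Unique (us ++ vs) → Unique us × Unique vs
  ++-Unique []       p       = [] , p
  ++-Unique (u ∷ us) (p ∷ q) with ++-Unique us q
  ... | qu , qv = All.tabulate (λ i → All.lookup p (∈-++⁺ˡ i)) ∷ qu , qv

  -- The new gate takes the last index, so its wires go upward and `inject₁` preserves the order of
  -- the old gates. Its children are former roots, which are distinct, so no parallel arcs arise.
  module Push {cs ts : List (Tree n)} (l : Label n) (childless : isInput l ≡ true → cs ≡ [])
    (b : Build (cs ++ ts)) where
    open Build b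

    us vs : List (Fin K)
    us = proj₁ (split-Pointwise cs reps)
    vs = proj₁ (proj₂ (split-Pointwise cs reps))

    roots≡ : roots ≡ us ++ vs
    roots≡ = proj₁ (proj₂ (proj₂ (split-Pointwise cs reps)))

    repU : Pointwise (Rep lab ch) us cs
    repU = proj₁ (proj₂ (proj₂ (proj₂ (split-Pointwise cs reps))))

    repV : Pointwise (Rep lab ch) vs ts
    repV = proj₂ (proj₂ (proj₂ (proj₂ (split-Pointwise cs reps))))

    lab′ : Fin (suc K) → Label n
    lab′ i with view i
    ... | ‵fromℕ     = l
    ... | ‵inject₁ j = lab j

    ch′ : Fin (suc K) → List (Fin (suc K))
    ch′ i with view i
    ... | ‵fromℕ     = map inject₁ us
    ... | ‵inject₁ j = map inject₁ (ch j)

    lab′-new : lab′ (fromℕ K) ≡ l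
    lab′-new rewrite view-fromℕ K = refl

    ch′-new : ch′ (fromℕ K) ≡ map inject₁ us
    ch′-new rewrite view-fromℕ K = refl

    lab′-old : ∀ j → lab′ (inject₁ j) ≡ lab j
    lab′-old j rewrite view-inject₁ j = refl

    ch′-old : ∀ j → ch′ (inject₁ j) ≡ map inject₁ (ch j)
    ch′-old j rewrite view-inject₁ j = refl

    inject₁-< : ∀ {j i : Fin K} → j <ᶠ i → inject₁ j <ᶠ inject₁ i
    inject₁-< {j} {i} p rewrite toℕ-inject₁ j | toℕ-inject₁ i = p

    inject₁<fromℕ : ∀ (j : Fin K) → inject₁ j <ᶠ fromℕ K
    inject₁<fromℕ j rewrite toℕ-inject₁ j | toℕ-fromℕ K = toℕ<n j

    ordered′ : ∀ i j → j ∈ ch′ i → j <ᶠ i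
    ordered′ i j p with view i
    ... | ‵fromℕ with ∈-map⁻ inject₁ p
    ...   | u , _ , refl = inject₁<fromℕ u
    ordered′ _ j p | ‵inject₁ i with ∈-map⁻ inject₁ p
    ...   | u , q , refl = inject₁-< (ordered i u q)

    distinct′ : Unique us × Unique vs
    distinct′ = ++-Unique us (subst Unique roots≡ distinct)

    noDup′ : ∀ i → Unique (ch′ i)
    noDup′ i with view i
    ... | ‵fromℕ     = Uniqueₚ.map⁺ inject₁-injective (proj₁ distinct′)
    ... | ‵inject₁ j = Uniqueₚ.map⁺ inject₁-injective (noDup j)

    sources′ : ∀ i → isInput (lab′ i) ≡ true → ch′ i ≡ []
    sources′ i p with view i
    ... | ‵fromℕ     = cong (map inject₁) (no-us (Pointwise-length repU) (childless p))
      where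
      no-us : ∀ {us : List (Fin K)} → length us ≡ length cs → cs ≡ [] → us ≡ []
      no-us {[]}    _  _    = refl
      no-us {_ ∷ _} () refl
    ... | ‵inject₁ j = cong (map inject₁) (sources j p)

    rep-old  : ∀ {g t} → Rep lab ch g t → Rep lab′ ch′ (inject₁ g) t
    rep-old* : ∀ {gs ss} → Pointwise (Rep lab ch) gs ss → Pointwise (Rep lab′ ch′) (map inject₁ gs) ss
    rep-old {g} (rep {ts = ss} eq ps) = rep (trans (lab′-old g) eq)
      (subst (λ c → Pointwise (Rep lab′ ch′) c ss) (sym (ch′-old g)) (rep-old* ps))
    rep-old* []       = []
    rep-old* (p ∷ ps) = rep-old p ∷ rep-old* ps

    rep-new : Rep lab′ ch′ (fromℕ K) (tree l cs)
    rep-new = rep lab′-new (subst (λ c → Pointwise (Rep lab′ ch′) c cs) (sym ch′-new) (rep-old* repU))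

    used′ : ∀ i → i ∈ fromℕ K ∷ map inject₁ vs ⊎ ∃ λ j → i ∈ ch′ j
    used′ i with view i
    ... | ‵fromℕ = inj₁ (here refl)
    ... | ‵inject₁ i with used i
    ...   | inj₂ (j , p) = inj₂ (inject₁ j , subst (inject₁ i ∈_) (sym (ch′-old j)) (∈-map⁺ inject₁ p))
    ...   | inj₁ p with ∈-++⁻ us (subst (i ∈_) roots≡ p)
    ...     | inj₁ q = inj₂ (fromℕ K , subst (inject₁ i ∈_) (sym ch′-new) (∈-map⁺ inject₁ q))
    ...     | inj₂ q = inj₁ (there (∈-map⁺ inject₁ q))

    total′ : sumFin (length ∘ ch′) ≡ arcs* (tree l cs ∷ ts)
    total′ = begin
      sumFin (length ∘ ch′)                                       ≡⟨ sumFin-last (length ∘ ch′) ⟩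
      length (ch′ (fromℕ K)) + sumFin (length ∘ ch′ ∘ inject₁)    ≡⟨ cong₂ _+_ newLength (cong sum (tabulate-cong oldLength)) ⟩
      length cs + sumFin (length ∘ ch)                            ≡⟨ cong (length cs +_) (trans total (arcs*-++ cs ts)) ⟩
      length cs + (arcs* cs + arcs* ts)                           ≡⟨ sym (+-assoc (length cs) _ _) ⟩
      arcs* (tree l cs ∷ ts)                                      ∎
      where
      open ≡-Reasoning
      newLength : length (ch′ (fromℕ K)) ≡ length cs
      newLength = trans (cong length ch′-new) (trans (length-map inject₁ us) (Pointwise-length repU))
      oldLength : ∀ j → length (ch′ (inject₁ j)) ≡ length (ch j)
      oldLength j = trans (cong length (ch′-old j)) (length-map inject₁ (ch j))

    push : Build (tree l cs ∷ ts)
    push = record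
      { K = suc K ; lab = lab′ ; ch = ch′ ; roots = fromℕ K ∷ map inject₁ vs
      ; ordered = ordered′ ; noDup = noDup′ ; sources = sources′
      ; distinct = All.tabulate fresh ∷ Uniqueₚ.map⁺ inject₁-injective (proj₂ distinct′)
      ; used = used′ ; reps = rep-new ∷ rep-old* repV ; total = total′ }
      where
      fresh : ∀ {i} → i ∈ map inject₁ vs → fromℕ K ≢ i
      fresh p with ∈-map⁻ inject₁ p
      ... | _ , _ , refl = fromℕ≢inject₁

  build  : ∀ {ts} t → InputsChildless t → Build ts → Build (t ∷ ts)
  build* : ∀ {ts} us → InputsChildless* us → Build ts → Build (us ++ ts)
  build (tree l us) (p , q) b = Push.push l p (build* us q b)
  build* []       _       b = b
  build* (u ∷ us) (p , q) b = build u p (build* us q b)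

  empty : Build []
  empty = record
    { K = 0 ; lab = λ () ; ch = λ () ; roots = [] ; ordered = λ () ; noDup = λ () ; sources = λ ()
    ; distinct = [] ; used = λ () ; reps = [] ; total = refl }

  -- Starting from the empty stack, `build` leaves a single root. The last gate is nobody's child,
  -- since wires go upward, so it is this root, and every other gate has a parent.
  toCircuit : ∀ t → InputsChildless t →
    Σ (Circuit n) λ C → Rep (label C) (children C) (output C) t × size C ≡ arcs t
  toCircuit t childless with build t childless empty
  ... | record { K = suc m ; lab = lab ; ch = ch ; roots = g ∷ [] ; ordered = ordered ; noDup = noDup
               ; sources = sources ; used = used ; reps = r ∷ [] ; total = total } =
    record { m = m ; label = lab ; children = ch ; acyclic = ordered ; simple = noDup
           ; inputs = sources ; singleSink = sink }
    , subst (λ h → Rep lab ch h t) g≡top r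
    , trans (cong sum (map-tabulate id (length ∘ ch))) (trans total (ℕₚ.+-identityʳ (arcs t)))
    where
    g≡top : g ≡ fromℕ m
    g≡top with used (fromℕ m)
    ... | inj₁ (here p)  = sym p
    ... | inj₂ (j , p)   = ⊥-elim (ℕₚ.<⇒≱ (ordered j _ p) (Finₚ.≤fromℕ j))
    sink : ∀ i → i ≢ fromℕ m → ∃ λ j → i ∈ ch j
    sink i i≢ with used i
    ... | inj₁ (here p)  = ⊥-elim (i≢ (trans p g≡top))
    ... | inj₂ q         = q
  ... | record { K = zero ; roots = () ∷ _ }

-- Tree-shaped compressed SDDs

false≢true : false ≢ true
false≢true ()

module _ {n : ℕ} (C : Circuit n) where

  Val-functional : ∀ {a g b b′} → Val C a g b → Val C a g b′ → b ≡ b′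
  Val-functional (v-lit p)      (v-lit q)      with refl ← trans (sym p) q = refl
  Val-functional (v-const p)    (v-const q)    with refl ← trans (sym p) q = refl
  Val-functional (v-or1 _ _ _)  (v-or1 _ _ _)  = refl
  Val-functional (v-or1 _ i v)  (v-or0 _ vs)   = ⊥-elim (false≢true (sym (Val-functional v (vs i))))
  Val-functional (v-or0 _ vs)   (v-or1 _ i v)  = ⊥-elim (false≢true (Val-functional (vs i) v))
  Val-functional (v-or0 _ _)    (v-or0 _ _)    = refl
  Val-functional (v-and0 _ _ _) (v-and0 _ _ _) = refl
  Val-functional (v-and0 _ i v) (v-and1 _ vs)  = ⊥-elim (false≢true (Val-functional v (vs i)))
  Val-functional (v-and1 _ vs)  (v-and0 _ i v) = ⊥-elim (false≢true (sym (Val-functional (vs i) v)))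
  Val-functional (v-and1 _ _)   (v-and1 _ _)   = refl
  Val-functional (v-lit p)      (v-const q)    with () ← trans (sym p) q
  Val-functional (v-lit p)      (v-or1 q _ _)  with () ← trans (sym p) q
  Val-functional (v-lit p)      (v-or0 q _)    with () ← trans (sym p) q
  Val-functional (v-lit p)      (v-and0 q _ _) with () ← trans (sym p) q
  Val-functional (v-lit p)      (v-and1 q _)   with () ← trans (sym p) q
  Val-functional (v-const p)    (v-lit q)      with () ← trans (sym p) q
  Val-functional (v-const p)    (v-or1 q _ _)  with () ← trans (sym p) q
  Val-functional (v-const p)    (v-or0 q _)    with () ← trans (sym p) q
  Val-functional (v-const p)    (v-and0 q _ _) with () ← trans (sym p) q
  Val-functional (v-const p)    (v-and1 q _)   with () ← trans (sym p) q
  Val-functional (v-or1 p _ _)  (v-lit q)      with () ← trans (sym p) q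
  Val-functional (v-or1 p _ _)  (v-const q)    with () ← trans (sym p) q
  Val-functional (v-or1 p _ _)  (v-and0 q _ _) with () ← trans (sym p) q
  Val-functional (v-or1 p _ _)  (v-and1 q _)   with () ← trans (sym p) q
  Val-functional (v-or0 p _)    (v-lit q)      with () ← trans (sym p) q
  Val-functional (v-or0 p _)    (v-const q)    with () ← trans (sym p) q
  Val-functional (v-or0 p _)    (v-and0 q _ _) with () ← trans (sym p) q
  Val-functional (v-or0 p _)    (v-and1 q _)   with () ← trans (sym p) q
  Val-functional (v-and0 p _ _) (v-lit q)      with () ← trans (sym p) q
  Val-functional (v-and0 p _ _) (v-const q)    with () ← trans (sym p) q
  Val-functional (v-and0 p _ _) (v-or1 q _ _)  with () ← trans (sym p) q
  Val-functional (v-and0 p _ _) (v-or0 q _)    with () ← trans (sym p) q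
  Val-functional (v-and1 p _)   (v-lit q)      with () ← trans (sym p) q
  Val-functional (v-and1 p _)   (v-const q)    with () ← trans (sym p) q
  Val-functional (v-and1 p _)   (v-or1 q _ _)  with () ← trans (sym p) q
  Val-functional (v-and1 p _)   (v-or0 q _)    with () ← trans (sym p) q

-- Sdd T f s: f is computed by a tree-shaped compressed SDD respecting T with
-- at most s arcs.  The 3 in cost counts the wire into the ∨-gate and the two
-- wires into the ∧-gate of the element.
data Sdd {n : ℕ} (T : VTree n) (f : BoolFun n) (s : ℕ) : Set

record Element {n : ℕ} (l r : VTree n) : Set where
  inductive
  field
    prime sub           : BoolFun n
    {primeTree subTree} : VTree n
    {primeSize subSize} : ℕ
    primeTree⊑          : primeTree ⊑ l
    subTree⊑            : subTree ⊑ r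
    primeSdd            : Sdd primeTree prime primeSize
    subSdd              : Sdd subTree sub subSize
    satisfiable         : ∃ λ a → prime a ≡ true

  cost : ℕ
  cost = 3 + (primeSize + subSize)

open Element

Disjoint Separated : ∀ {n} {l r : VTree n} → Element l r → Element l r → Set
Disjoint  e e′ = ∀ a → ¬ (prime e a ≡ true × prime e′ a ≡ true)
Separated e e′ = ∃ λ a → sub e′ a ≡ not (sub e a)

data Sdd {n} T f s where
  sdd-lit   : ∀ x p → leaf x ⊑ T → (∀ a → f a ≡ litVal p (a x)) → Sdd T f s
  sdd-const : ∀ b → (∀ a → f a ≡ b) → Sdd T f s
  sdd-dec   : ∀ {l r} → node l r ⊑ T → (es : List (Element l r)) → 2 ≤ length es →
    AllPairs Disjoint es → AllPairs Separated es →
    (∀ a → Any (λ e → prime e a ≡ true × f a ≡ sub e a) es) →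
    sum (map cost es) ≤ s → Sdd T f s

module _ {n : ℕ} where

  toTree  : ∀ {T : VTree n} {f s} → Sdd T f s → Tree n
  toTrees : ∀ {l r : VTree n} → List (Element l r) → List (Tree n)
  toTree (sdd-lit x p _ _)          = tree (lit x p) []
  toTree (sdd-const b _)            = tree (const b) []
  toTree (sdd-dec _ es _ _ _ _ _)   = tree ∨g (toTrees es)
  toTrees []       = []
  toTrees (e ∷ es) = tree ∧g (toTree (primeSdd e) ∷ toTree (subSdd e) ∷ []) ∷ toTrees es

  toTree-sources  : ∀ {T : VTree n} {f s} (d : Sdd T f s) → InputsChildless (toTree d)
  toTrees-sources : ∀ {l r : VTree n} (es : List (Element l r)) → InputsChildless* (toTrees es)
  toTree-sources (sdd-lit x p _ _)        = (λ _ → refl) , tt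
  toTree-sources (sdd-const b _)          = (λ _ → refl) , tt
  toTree-sources (sdd-dec _ es _ _ _ _ _) = (λ ()) , toTrees-sources es
  toTrees-sources []       = tt
  toTrees-sources (e ∷ es) =
    ((λ ()) , toTree-sources (primeSdd e) , toTree-sources (subSdd e) , tt) , toTrees-sources es

  arcs-toTree  : ∀ {T : VTree n} {f s} (d : Sdd T f s) → arcs (toTree d) ≤ s
  arcs-toTrees : ∀ {l r : VTree n} (es : List (Element l r)) →
    length (toTrees es) + arcs* (toTrees es) ≤ sum (map cost es)
  arcs-toTree (sdd-lit x p _ _)         = z≤n
  arcs-toTree (sdd-const b _)           = z≤n
  arcs-toTree (sdd-dec _ es _ _ _ _ le) = ≤-trans (arcs-toTrees es) le
  arcs-toTrees []       = z≤n
  arcs-toTrees (e ∷ es) = ≤-trans (≤-reflexive (regroup (length (toTrees es)) (arcs (toTree (primeSdd e))) (arcs (toTree (subSdd e))) (arcs* (toTrees es))))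
    (+-mono-≤ (ℕₚ.+-monoʳ-≤ 3 (+-mono-≤ (arcs-toTree (primeSdd e)) (arcs-toTree (subSdd e))))
              (arcs-toTrees es))
    where
    regroup : ∀ L p s E → suc L + ((2 + (p + (s + 0))) + E) ≡ (3 + (p + s)) + (L + E)
    regroup = solve-∀

module _ {A B : Set} {R : A → B → Set} where

  transfer-All : ∀ {P : A → Set} → (∀ {x y} → R x y → P x) → ∀ {xs ys} → Pointwise R xs ys → All P xs
  transfer-All h []       = []
  transfer-All h (r ∷ rs) = h r ∷ transfer-All h rs

  transfer-Any : ∀ {P : A → Set} {Q : B → Set} → (∀ {x y} → R x y → Q y → P x) →
    ∀ {xs ys} → Pointwise R xs ys → Any Q ys → Any P xs
  transfer-Any h (r ∷ rs) (here q)  = here (h r q)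
  transfer-Any h (r ∷ rs) (there q) = there (transfer-Any h rs q)

  transfer-AllPairs : ∀ {P : A → A → Set} {Q : B → B → Set} →
    (∀ {x y x′ y′} → R x y → R x′ y′ → Q y y′ → P x x′) →
    ∀ {xs ys} → Pointwise R xs ys → AllPairs Q ys → AllPairs P xs
  transfer-AllPairs {P} {Q} h []       []       = []
  transfer-AllPairs {P} {Q} h (r ∷ rs) (q ∷ qs) = row rs q ∷ transfer-AllPairs h rs qs
    where
    row : ∀ {xs ys} → Pointwise R xs ys → All (Q _) ys → All (P _) xs
    row []       []       = []
    row (s ∷ ss) (p ∷ ps) = h r s p ∷ row ss ps

AllPairs-lookup : ∀ {A : Set} {P : A → A → Set} {xs} → AllPairs P xs →
  ∀ i j → i <ᶠ j → P (lookup xs i) (lookup xs j)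
AllPairs-lookup {xs = x ∷ xs} (p ∷ ps) zero    (suc j) _       = All.lookup p (∈-lookup j)
AllPairs-lookup {xs = x ∷ xs} (p ∷ ps) (suc i) (suc j) (s≤s q) = AllPairs-lookup ps i j q

Pointwise-pair : ∀ {A B : Set} {R : A → B → Set} {xs y z} → Pointwise R xs (y ∷ z ∷ []) →
  ∃ λ u → ∃ λ v → xs ≡ u ∷ v ∷ [] × R u y × R v z
Pointwise-pair (p ∷ q ∷ []) = _ , _ , refl , p , q

module Realise {n : ℕ} (C : Circuit n) where

  Represents : Gate C → Tree n → Set
  Represents = Rep (label C) (children C)

  -- Both facts go through one induction, because the side conditions of `sdd-dec` in `SDDAt` speak
  -- of the values of primes and subs.
  record Realises (T : VTree n) (f : BoolFun n) (g : Gate C) : Set where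
    constructor _,_
    field
      computes : ∀ a → Val C a g (f a)
      isSDD    : SDDAt C true T g

  open Realises

  record RealisesElement {l r : VTree n} (ps : Gate C × Gate C) (e : Element l r) : Set where
    constructor _,_
    field
      realPrime : Realises (primeTree e) (prime e) (proj₁ ps)
      realSub   : Realises (subTree e) (sub e) (proj₂ ps)

  value : ∀ {T f g a b} → Realises T f g → f a ≡ b → Val C a g b
  value {a = a} r refl = computes r a

  value⁻ : ∀ {T f g a b} → Realises T f g → Val C a g b → f a ≡ b
  value⁻ {a = a} r v = Val-functional C (computes r a) v

  -- The `∧`-gate of the element with true prime has the value of its sub. By disjointness all other
  -- primes are false, and so are their `∧`-gates.
  or-value : ∀ {l r : VTree n} {a : Assignment n} {b g ps} {es : List (Element l r)} → label C g ≡ ∨g →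
    Pointwise (AndOf C) (children C g) ps → Pointwise RealisesElement ps es →
    AllPairs Disjoint es →
    Any (λ e → prime e a ≡ true × b ≡ sub e a) es → Val C a g b
  or-value {l} {r} {a} {b} lab ands reals disj any = go b refl
    where
    true-child : ∀ {cs ps} {es : List (Element l r)} → b ≡ true → Pointwise (AndOf C) cs ps →
      Pointwise RealisesElement ps es →
      Any (λ e → prime e a ≡ true × b ≡ sub e a) es → ∃ λ c → c ∈ cs × Val C a c true
    true-child ft ((l , ch) ∷ _) ((p , s) ∷ _) (here (pt , fs)) =
      _ , here refl , v-and1 l λ i → both (subst (_ ∈_) ch i)
      where
      both : ∀ {c} → c ∈ _ ∷ _ ∷ [] → Val C a c true
      both (here refl)         = value p pt
      both (there (here refl)) = value s (trans (sym fs) ft)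
    true-child ft (_ ∷ ands) (_ ∷ rs) (there h) with true-child ft ands rs h
    ... | c , i , v = c , there i , v

    off : ∀ {c p s} {e : Element l r} → AndOf C c (p , s) → RealisesElement (p , s) e →
      prime e a ≡ false → Val C a c false
    off (l , ch) (p , _) pf = v-and0 l (subst (_ ∈_) (sym ch) (here refl)) (value p pf)

    all-off : ∀ {cs ps} {es : List (Element l r)} → Pointwise (AndOf C) cs ps →
      Pointwise RealisesElement ps es → All (λ e → prime e a ≡ false) es → ∀ {c} → c ∈ cs → Val C a c false
    all-off (x ∷ xs) (y ∷ ys) (z ∷ zs) (here refl) = off x y z
    all-off (x ∷ xs) (y ∷ ys) (z ∷ zs) (there i)   = all-off xs ys zs i

    false-child : ∀ {cs ps} {es : List (Element l r)} → b ≡ false → Pointwise (AndOf C) cs ps →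
      Pointwise RealisesElement ps es →
      AllPairs Disjoint es →
      Any (λ e → prime e a ≡ true × b ≡ sub e a) es → ∀ {c} → c ∈ cs → Val C a c false
    false-child ff ((l , ch) ∷ _) ((p , s) ∷ _) _ (here (pt , fs)) (here refl) =
      v-and0 l (subst (_ ∈_) (sym ch) (there (here refl))) (value s (trans (sym fs) ff))
    false-child ff (_ ∷ ands) (_ ∷ rs) (d ∷ _) (here (pt , fs)) (there i) =
      all-off ands rs (All.map (λ h → ¬-not λ q → h a (pt , q)) d) i
    false-child ff (x ∷ _) (y ∷ _) (d ∷ _) (there h) (here refl) =
      off x y (¬-not λ q → All.lookupWith (λ { k (r , _) → k a (q , r) }) d h)
    false-child ff (_ ∷ ands) (_ ∷ rs) (_ ∷ ds) (there h) (there i) = false-child ff ands rs ds h i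

    go : ∀ b′ → b ≡ b′ → Val C a _ b′
    go true  ft with true-child ft ands reals any
    ... | c , i , v = v-or1 lab i v
    go false ff = v-or0 lab (false-child ff ands reals disj any)

  realise  : ∀ {T f s g} (d : Sdd T f s) → Represents g (toTree d) → Realises T f g
  realise* : ∀ {l r : VTree n} {cs} (es : List (Element l r)) →
    Pointwise Represents cs (toTrees es) →
    ∃ λ ps → Pointwise (AndOf C) cs ps × Pointwise RealisesElement ps es
  realise (sdd-lit x p x⊑ eq) (rep lab _) =
    (λ a → subst (Val C a _) (sym (eq a)) (v-lit lab)) , sdd-lit lab x⊑
  realise (sdd-const b eq) (rep lab _) =
    (λ a → subst (Val C a _) (sym (eq a)) (v-const lab)) , sdd-const lab
  realise (sdd-dec {l} {r} lr⊑ es two disj sep cover _) (rep lab reps)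
    with realise* es reps
  ... | ps , ands , reals =
    (λ a → or-value lab ands reals disj (cover a)) ,
    sdd-dec l r ps lr⊑ lab ands
      (subst (2 ≤_) (sym (Pointwise-length reals)) two)
      (λ i → All.lookup (transfer-All {P = λ q → ∃ λ T₁ → T₁ ⊑ l × SDDAt C true T₁ (proj₁ q)}
         (λ { {_} {e} (p , s) → _ , primeTree⊑ e , isSDD p }) reals) (∈-lookup i))
      (λ i → All.lookup (transfer-All {P = λ q → ∃ λ T₂ → T₂ ⊑ r × SDDAt C true T₂ (proj₂ q)}
         (λ { {_} {e} (p , s) → _ , subTree⊑ e , isSDD s }) reals) (∈-lookup i))
      (λ i → All.lookup (transfer-All {P = λ q → ∃ λ a → Val C a (proj₁ q) true}
         (λ { {_} {e} (p , s) → proj₁ (satisfiable e) , value p (proj₂ (satisfiable e)) }) reals)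
         (∈-lookup i))
      (AllPairs-lookup (transfer-AllPairs
         {P = λ q q′ → ∀ a → ¬ (Val C a (proj₁ q) true × Val C a (proj₁ q′) true)}
         (λ { (p , _) (p′ , _) h a (v , v′) → h a (value⁻ p v , value⁻ p′ v′) }) reals disj))
      (λ a → witness (transfer-Any {P = λ q → Val C a (proj₁ q) true}
         (λ { (p , _) (t , _) → value p t }) reals (cover a)))
      (λ _ → AllPairs-lookup (transfer-AllPairs
         {P = λ q q′ → ∃ λ a → ∃ λ b → Val C a (proj₂ q) b × Val C a (proj₂ q′) (not b)}
         (λ { (_ , s) (_ , s′) (a , h) → a , _ , computes s a , value s′ h }) reals sep))
    where
    witness : ∀ {A : Set} {P : A → Set} {xs} → Any P xs → ∃ λ i → P (lookup xs i)
    witness h = Any.index h , lookup-index h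
  realise* [] [] = [] , [] , []
  realise* (e ∷ es) (rep lab two ∷ rs) with realise* es rs | Pointwise-pair two
  ... | ps , ands , reals | p , s , ch , rp , rs′ =
    (p , s) ∷ ps , (lab , ch) ∷ ands , (realise (primeSdd e) rp , realise (subSdd e) rs′) ∷ reals

Sdd⇒SDDcSize≤ : ∀ {n} {T : VTree n} {f s} → IsVtree T → Sdd T f s → SDDcSize≤ f s
Sdd⇒SDDcSize≤ {T = T} isV d with toCircuit (toTree d) (toTree-sources d)
... | C , r , size≡ = C , (T , isV , isSDD) , computes , ≤-trans (≤-reflexive size≡) (arcs-toTree d)
  where open Realise.Realises (Realise.realise C d r)

-- Branching on the first true key

⊑-trans : ∀ {n} {R S T : VTree n} → R ⊑ S → S ⊑ T → R ⊑ T
⊑-trans p here      = p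
⊑-trans p (left q)  = left (⊑-trans p q)
⊑-trans p (right q) = right (⊑-trans p q)

weaken : ∀ {n} {S T : VTree n} {f s t} → S ⊑ T → s ≤ t → Sdd S f s → Sdd T f t
weaken p le (sdd-lit x b q eq)                = sdd-lit x b (⊑-trans q p) eq
weaken p le (sdd-const b eq)                  = sdd-const b eq
weaken p le (sdd-dec q es two disj sep cov c) = sdd-dec (⊑-trans q p) es two disj sep cov (≤-trans c le)

litVal-true : ∀ p {v} → litVal p v ≡ true → v ≡ p
litVal-true true  {true}  _ = refl
litVal-true false {false} _ = refl

litVal-refl : ∀ p → litVal p p ≡ true
litVal-refl true  = refl
litVal-refl false = refl

litVal-not : ∀ p v → litVal (not p) v ≡ not (litVal p v)
litVal-not true  v     = refl
litVal-not false v = sym (not-involutive v)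

rightLinear : ∀ {n} → List (Fin n) → Fin n → VTree n
rightLinear []       z = leaf z
rightLinear (x ∷ xs) z = node (leaf x) (rightLinear xs z)

leaves-rightLinear : ∀ {n} (xs : List (Fin n)) z → leaves (rightLinear xs z) ≡ xs ++ z ∷ []
leaves-rightLinear []       z = refl
leaves-rightLinear (x ∷ xs) z = cong (x ∷_) (leaves-rightLinear xs z)

module _ {n : ℕ} (vars : List (Fin n)) (a₀ : Assignment n) where
  open import Data.List.Membership.DecPropositional (Finₚ._≟_ {n}) using (_∈?_)

  cube : List (Fin n) → BoolFun n
  cube []       a = true
  cube (x ∷ xs) a = (if does (x ∈? vars) then litVal (a₀ x) (a x) else true) ∧ cube xs a

  cube⁺ : ∀ xs {a} → (∀ {x} → x ∈ vars → a x ≡ a₀ x) → cube xs a ≡ true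
  cube⁺ []       h = refl
  cube⁺ (x ∷ xs) h with x ∈? vars
  ... | yes i = cong₂ _∧_ (trans (cong (litVal (a₀ x)) (h i)) (litVal-refl (a₀ x))) (cube⁺ xs h)
  ... | no  _ = cube⁺ xs h

  cube⁻ : ∀ {xs a} → cube xs a ≡ true → ∀ {x} → x ∈ xs → x ∈ vars → a x ≡ a₀ x
  cube⁻ {y ∷ xs} {a} eq i j with y ∈? vars | litVal (a₀ y) (a y) in lv
  cube⁻ {y ∷ xs} {a} eq (here refl) j | yes _ | true = litVal-true (a₀ y) lv
  cube⁻ {y ∷ xs} {a} eq (there i)   j | yes _ | true = cube⁻ eq i j
  cube⁻ {y ∷ xs} {a} eq (here refl) j | no ∉  | _ = ⊥-elim (∉ j)
  cube⁻ {y ∷ xs} {a} eq (there i)   j | no _  | _ = cube⁻ eq i j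

  -- The extra leaf `z` gives even the last variable of the cube a right subtree, so every literal
  -- is handled by the same two-element decomposition, of cost 3 + 3.
  cubeSdd : ∀ xs z → Sdd (rightLinear xs z) (cube xs) (6 * length xs)
  cubeSdd []       z = sdd-const true λ _ → refl
  cubeSdd (x ∷ xs) z with x ∈? vars
  -- A variable outside the cube is skipped: deciding it would create two equal subs and violate
  -- compression.
  ... | no _  = weaken (right here) (ℕₚ.*-monoʳ-≤ 6 (ℕₚ.n≤1+n (length xs))) (cubeSdd xs z)
  ... | yes _ = sdd-dec here (agree ∷ differ ∷ []) ≤-refl
      (((λ { a (p , q) → not-¬ (litVal-true (a₀ x) p) (litVal-true (not (a₀ x)) q) }) ∷ []) ∷ [] ∷ [])
      (((a₀ , sym (cong not (cube⁺ xs (λ _ → refl)))) ∷ []) ∷ [] ∷ [])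
      cover
      (≤-reflexive (total (length xs)))
    where
    agree differ : Element (leaf x) (rightLinear xs z)
    agree = record
      { prime = λ a → litVal (a₀ x) (a x) ; sub = cube xs ; primeTree⊑ = here ; subTree⊑ = here
      ; primeSdd = sdd-lit {s = 0} x (a₀ x) here (λ _ → refl) ; subSdd = cubeSdd xs z
      ; satisfiable = a₀ , litVal-refl (a₀ x) }
    differ = record
      { prime = λ a → litVal (not (a₀ x)) (a x) ; sub = λ _ → false ; primeTree⊑ = here ; subTree⊑ = here
      ; primeSdd = sdd-lit {s = 0} x (not (a₀ x)) here (λ _ → refl) ; subSdd = sdd-const {s = 0} false (λ _ → refl)
      ; satisfiable = (λ y → not (a₀ y)) , litVal-refl (not (a₀ x)) }
    cover : ∀ a → Any (λ e → prime e a ≡ true × litVal (a₀ x) (a x) ∧ cube xs a ≡ sub e a) (agree ∷ differ ∷ [])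
    cover a with litVal (a₀ x) (a x) in eq
    ... | true  = here (eq , refl)
    ... | false = there (here (trans (litVal-not (a₀ x) (a x)) (cong not eq) , refl))
    total : ∀ m → 3 + (0 + 6 * m) + (3 + 0 + 0) ≡ 6 * suc m
    total = solve-∀

first : ∀ {k} → (Fin k → Bool) → Maybe (Fin k)
first {zero}  p = nothing
first {suc k} p = if p zero then just zero else Maybe.map suc (first (p ∘ suc))

first-cong : ∀ {k} {p q : Fin k → Bool} → (∀ i → p i ≡ q i) → first p ≡ first q
first-cong {zero}  h = refl
first-cong {suc k} {p} {q} h rewrite h zero | first-cong {p = p ∘ suc} {q ∘ suc} (h ∘ suc) = refl

first-none : ∀ k → first {k} (λ _ → false) ≡ nothing
first-none zero    = refl
first-none (suc k) rewrite first-none k = refl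

single : ∀ {k} → Fin k → Fin k → Bool
single i j = does (i Finₚ.≟ j)

first-single : ∀ {k} (i : Fin k) → first (single i) ≡ just i
first-single zero    = refl
first-single (suc i) = cong (Maybe.map suc) (first-single i)

module _ {n : ℕ} where

  -- The variables that have to be read in order to know the first true key.
  firstVars : ∀ {k} → (Fin k → Fin n) → Maybe (Fin k) → List (Fin n)
  firstVars {zero}  κ m              = []
  firstVars {suc k} κ nothing        = κ zero ∷ firstVars (κ ∘ suc) nothing
  firstVars {suc k} κ (just zero)    = κ zero ∷ []
  firstVars {suc k} κ (just (suc i)) = κ zero ∷ firstVars (κ ∘ suc) (just i)

  firstVars⊆ : ∀ {k} (κ : Fin k → Fin n) m {xs} → (∀ j → κ j ∈ xs) → ∀ {x} → x ∈ firstVars κ m → x ∈ xs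
  firstVars⊆ {suc k} κ nothing        h (here refl) = h zero
  firstVars⊆ {suc k} κ nothing        h (there i)   = firstVars⊆ (κ ∘ suc) nothing (h ∘ suc) i
  firstVars⊆ {suc k} κ (just zero)    h (here refl) = h zero
  firstVars⊆ {suc k} κ (just (suc j)) h (here refl) = h zero
  firstVars⊆ {suc k} κ (just (suc j)) h (there i)   = firstVars⊆ (κ ∘ suc) (just j) (h ∘ suc) i

  module _ {a a′ : Assignment n} where

    -- Together with the converse `firstVars-forced`, this makes the event `first (a ∘ κ) ≡ m` a
    -- cube in the variables `firstVars κ m`, described by any one assignment that belongs to it.
    firstVars-sound : ∀ {k} (κ : Fin k → Fin n) m → first (a ∘ κ) ≡ m →
      (∀ {x} → x ∈ firstVars κ m → a x ≡ a′ x) → first (a′ ∘ κ) ≡ m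
    firstVars-sound {zero}  κ nothing eq h = refl
    firstVars-sound {suc k} κ m eq h with a (κ zero) in a0 | first (a ∘ κ ∘ suc) in rest
    firstVars-sound {suc k} κ (just zero)    eq h | true  | _
      rewrite sym (h (here refl)) | a0 = refl
    firstVars-sound {suc k} κ nothing        eq h | false | nothing
      rewrite sym (h (here refl)) | a0 = cong (Maybe.map suc) (firstVars-sound (κ ∘ suc) nothing rest (h ∘ there))
    firstVars-sound {suc k} κ (just (suc i)) refl h | false | just .i
      rewrite sym (h (here refl)) | a0 = cong (Maybe.map suc) (firstVars-sound (κ ∘ suc) (just i) rest (h ∘ there))

    firstVars-forced : ∀ {k} (κ : Fin k → Fin n) m → first (a ∘ κ) ≡ m → first (a′ ∘ κ) ≡ m →
      ∀ {x} → x ∈ firstVars κ m → a x ≡ a′ x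
    firstVars-forced {suc k} κ m eq eq′ i
      with a (κ zero) in a0 | a′ (κ zero) in a0′ | first (a ∘ κ ∘ suc) in rest | first (a′ ∘ κ ∘ suc) in rest′
    firstVars-forced {suc k} κ (just zero) eq eq′ (here refl) | true | true | _ | _ = trans a0 (sym a0′)
    firstVars-forced {suc k} κ nothing eq eq′ (here refl) | false | false | nothing | nothing = trans a0 (sym a0′)
    firstVars-forced {suc k} κ nothing eq eq′ (there i) | false | false | nothing | nothing =
      firstVars-forced (κ ∘ suc) nothing rest rest′ i
    firstVars-forced {suc k} κ (just (suc j)) refl refl (here refl) | false | false | just _ | just _ = trans a0 (sym a0′)
    firstVars-forced {suc k} κ (just (suc j)) refl refl (there i) | false | false | just _ | just _ =
      firstVars-forced (κ ∘ suc) (just j) rest rest′ i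
    firstVars-forced {suc k} κ _ refl () i | true | false | _ | nothing
    firstVars-forced {suc k} κ _ refl () i | true | false | _ | just _
    firstVars-forced {suc k} κ _ eq refl i | false | true | nothing | _ with () ← eq
    firstVars-forced {suc k} κ _ eq refl i | false | true | just _ | _ with () ← eq

Code : ℕ → Set
Code k = Maybe (Fin k × Bool)

codes : ∀ k → List (Code k)
codes k = nothing ∷ map just (cartesianProduct (allFin k) (true ∷ false ∷ []))

∈-codes : ∀ {k} (c : Code k) → c ∈ codes k
∈-codes nothing        = here refl
∈-codes (just (i , b)) = there (∈-map⁺ just (∈-cartesianProduct⁺ (∈-allFin i) (∈-bool b)))
  where
  ∈-bool : ∀ b → b ∈ true ∷ false ∷ []
  ∈-bool true  = here refl
  ∈-bool false = there (here refl)

codes-unique : ∀ k → Unique (codes k)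
codes-unique k = All.tabulate fresh ∷
  Uniqueₚ.map⁺ just-injective (Uniqueₚ.cartesianProduct⁺ (Uniqueₚ.allFin⁺ k) (((λ ()) ∷ []) ∷ [] ∷ []))
  where
  fresh : ∀ {c : Code k} → c ∈ map just _ → nothing ≢ c
  fresh i refl with () ← proj₂ (proj₂ (∈-map⁻ just i))

length-codes : ∀ k → length (codes k) ≡ suc (k * 2)
length-codes k = cong suc (trans (length-map just (cartesianProduct (allFin k) (true ∷ false ∷ [])))
  (trans (pairs (allFin k)) (cong (_* 2) (length-tabulate {n = k} _))))
  where
  pairs : ∀ (is : List (Fin k)) → length (cartesianProduct is (true ∷ false ∷ [])) ≡ length is * 2
  pairs []       = refl
  pairs (i ∷ is) = cong (2 +_) (pairs is)

-- Keys `κ` with a datum `δ i` for each. It is used at both levels: for the two data blocks, and for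
-- the address, where the role bit is the datum of every position.
module Selector {n k : ℕ} (κ δ : Fin k → Fin n) where

  select : Assignment n → Code k
  select a = Maybe.map (λ i → i , a (δ i)) (first (a ∘ κ))

  vars : Code k → List (Fin n)
  vars nothing        = firstVars κ nothing
  vars (just (i , _)) = δ i ∷ firstVars κ (just i)

  select-just : ∀ a {i} → first (a ∘ κ) ≡ just i → select a ≡ just (i , a (δ i))
  select-just a eq rewrite eq = refl

  select-nothing : ∀ a → first (a ∘ κ) ≡ nothing → select a ≡ nothing
  select-nothing a eq rewrite eq = refl

  vars⊆ : ∀ c {xs} → (∀ j → κ j ∈ xs) → (∀ j → δ j ∈ xs) → ∀ {x} → x ∈ vars c → x ∈ xs
  vars⊆ nothing        hκ hδ i           = firstVars⊆ κ nothing hκ i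
  vars⊆ (just (j , _)) hκ hδ (here refl) = hδ j
  vars⊆ (just (j , _)) hκ hδ (there i)   = firstVars⊆ κ (just j) hκ i

  select-sound : ∀ {a a′} c → select a ≡ c → (∀ {x} → x ∈ vars c → a x ≡ a′ x) → select a′ ≡ c
  select-sound {a} {a′} c eq h with first (a ∘ κ) in fst
  select-sound {a} {a′} _ refl h | nothing = select-nothing a′ (firstVars-sound κ nothing fst h)
  select-sound {a} {a′} _ refl h | just i  = trans (select-just a′ (firstVars-sound κ (just i) fst (h ∘ there)))
    (cong (λ b → just (i , b)) (sym (h (here refl))))

  select-forced : ∀ {a a′} c → select a ≡ c → select a′ ≡ c → ∀ {x} → x ∈ vars c → a x ≡ a′ x
  select-forced {a} {a′} c eq eq′ i with first (a ∘ κ) in fst | first (a′ ∘ κ) in fst′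
  select-forced _ refl refl i | nothing | nothing = firstVars-forced κ nothing fst fst′ i
  select-forced _ refl eq′ (here refl) | just j | just j′ with refl ← cong (Maybe.map proj₁) eq′ =
    -- Projects two equal `just` codes to their bits; `false` only makes the projection total.
    sym (cong (Maybe.maybe proj₂ false) eq′)
  select-forced _ refl eq′ (there i) | just j | just j′ with refl ← cong (Maybe.map proj₁) eq′ =
    firstVars-forced κ (just j) fst fst′ i

  module _ (xs : List (Fin n)) (z : Fin n) (κ∈ : ∀ j → κ j ∈ xs) (δ∈ : ∀ j → δ j ∈ xs)
    (witness : Code k → Assignment n) (select-witness : ∀ c → select (witness c) ≡ c)
    {T : VTree n} (branch : Code k → BoolFun n) {s : ℕ} (branchSdd : ∀ c → Sdd T (branch c) s)
    (separated : ∀ {c c′} → c ≢ c′ → ∃ λ a → branch c′ a ≡ not (branch c a))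
    (1≤k : 1 ≤ k)
    where

    element : Code k → Element (rightLinear xs z) T
    element c = record
      { prime = cube (vars c) (witness c) xs ; sub = branch c ; primeTree⊑ = here ; subTree⊑ = here
      ; primeSdd = cubeSdd (vars c) (witness c) xs z ; subSdd = branchSdd c
      ; satisfiable = witness c , cube⁺ (vars c) (witness c) xs (λ _ → refl) }

    prime⇒select : ∀ c {a} → prime (element c) a ≡ true → select a ≡ c
    prime⇒select c eq = select-sound c (select-witness c) λ i →
      sym (cube⁻ (vars c) (witness c) eq (vars⊆ c κ∈ δ∈ i) i)

    select⇒prime : ∀ a → prime (element (select a)) a ≡ true
    select⇒prime a = cube⁺ (vars (select a)) _ xs (select-forced (select a) refl (select-witness (select a)))

    elementsSize : ∀ cs → sum (map cost (map element cs)) ≡ length cs * (3 + (6 * length xs + s))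
    elementsSize []       = refl
    elementsSize (c ∷ cs) = cong ((3 + (6 * length xs + s)) +_) (elementsSize cs)

    -- One element per code. The cube of a code is exactly the event that `select` returns it, so
    -- the primes are disjoint and exhaustive. There are 2k + 1 codes, hence at least two elements
    -- once `1 ≤ k`.
    selectorSdd : Sdd (node (rightLinear xs z) T) (λ a → branch (select a) a)
      (suc (k * 2) * (3 + (6 * length xs + s)))
    selectorSdd = sdd-dec here (map element (codes k))
      (subst (2 ≤_) (sym (trans (length-map element (codes k)) (length-codes k)))
        (s≤s (≤-trans 1≤k (ℕₚ.m≤m*n k 2))))
      (AllPairsₚ.map⁺ (AllPairs.map (λ {c} {c′} c≢c′ a (p , q) →
        c≢c′ (trans (sym (prime⇒select c p)) (prime⇒select c′ q))) (codes-unique k)))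
      (AllPairsₚ.map⁺ (AllPairs.map separated (codes-unique k)))
      (λ a → Anyₚ.map⁺ (Any.map (λ { refl → select⇒prime a , refl }) (∈-codes (select a))))
      (≤-reflexive (trans (elementsSize (codes k)) (cong (_* (3 + (6 * length xs + s))) (length-codes k))))

-- Fooling sets for right-linear vtrees

length-concat : ∀ {A : Set} (xss : List (List A)) → length (concat xss) ≡ sum (map length xss)
length-concat []         = refl
length-concat (xs ∷ xss) = trans (length-++ xs) (cong (length xs +_) (length-concat xss))

-- Every gate but the sink is the source of an arc.
m≤size : ∀ {n} (C : Circuit n) → m C ≤ size C
m≤size C = subst (m C ≤_) arcs≡size (injective⇒≤ {f = arc} arc-injective)
  where
  sources : List (Gate C)
  sources = concat (map (children C) (allFin (suc (m C))))

  arcs≡size : length sources ≡ size C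
  arcs≡size = trans (length-concat (map (children C) (allFin (suc (m C))))) (cong sum (sym (map-∘ (allFin (suc (m C))))))

  source : ∀ i → inject₁ i ∈ sources
  source i with singleSink C (inject₁ i) (λ p → fromℕ≢inject₁ (sym p))
  ... | j , p = ∈-concat⁺′ p (∈-map⁺ (children C) (∈-allFin j))

  arc : Fin (m C) → Fin (length sources)
  arc i = Any.index (source i)

  arc-injective : ∀ {i j} → arc i ≡ arc j → i ≡ j
  arc-injective {i} {j} eq = inject₁-injective
    (trans (lookup-index (source i)) (trans (cong (lookup sources) eq) (sym (lookup-index (source j)))))

module _ {A B : Set} {R : A → B → Set} where

  Pointwise-∈ˡ : ∀ {xs ys x} → Pointwise R xs ys → x ∈ xs → ∃ λ i → R x (lookup ys i)
  Pointwise-∈ˡ (r ∷ rs) (here refl) = zero , r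
  Pointwise-∈ˡ (r ∷ rs) (there p) with Pointwise-∈ˡ rs p
  ... | i , s = suc i , s

  Pointwise-lookupʳ : ∀ {xs ys} → Pointwise R xs ys → ∀ i → ∃ λ x → x ∈ xs × R x (lookup ys i)
  Pointwise-lookupʳ (r ∷ rs) zero    = _ , here refl , r
  Pointwise-lookupʳ (r ∷ rs) (suc i) with Pointwise-lookupʳ rs i
  ... | x , p , s = x , there p , s

module _ {n : ℕ} where

  leaves-mono : ∀ {S T : VTree n} → S ⊑ T → ∀ {x} → x ∈ leaves S → x ∈ leaves T
  leaves-mono here                      i = i
  leaves-mono (left p)                  i = ∈-++⁺ˡ (leaves-mono p i)
  leaves-mono (right {l = l} p)         i = ∈-++⁺ʳ (leaves l) (leaves-mono p i)

  RightLinear-⊑ : ∀ {S T : VTree n} → S ⊑ T → RightLinear T → RightLinear S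
  RightLinear-⊑ here        rl           = rl
  RightLinear-⊑ (left here) (rl-node _)  = rl-leaf
  RightLinear-⊑ (right p)   (rl-node rl) = RightLinear-⊑ p rl

  -- The variables in L come after all the others in the order of T.
  Final : List (Fin n) → VTree n → Set
  Final L T = ∀ {x r} → node (leaf x) r ⊑ T → (∀ {y} → y ∈ leaves (node (leaf x) r) → y ∈ L) ⊎ x ∉ L

  -- A discrete intermediate value argument: going down the right spine removes one variable at a
  -- time, so `count` falls by at most one per step until it is zero, and it cannot jump over `h`.
  final-part : (count : List (Fin n) → ℕ) → count [] ≡ 0 → (∀ x L → count (x ∷ L) ≤ suc (count L)) →
    ∀ {T} → RightLinear T → Unique (leaves T) → ∀ h → h ≤ count (leaves T) →
    ∃ λ L → Final L T × (∀ {x} → x ∈ L → x ∈ leaves T) × count L ≡ h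
  final-part count c0 c+ {T} rl uniq h h≤ with ℕₚ.m≤n⇒m<n∨m≡n h≤
  ... | inj₂ refl = leaves T , (λ p → inj₁ (leaves-mono p)) , (λ i → i) , refl
  final-part count c0 c+ (rl-leaf {x}) uniq h h≤ | inj₁ h< =
    [] , (λ ()) , (λ ()) , trans c0 (sym (ℕₚ.n≤0⇒n≡0
      (subst (h ≤_) c0 (ℕₚ.≤-pred (≤-trans h< (c+ x []))))))
  final-part count c0 c+ (rl-node {x} {r} rl) (x∉ ∷ uniq) h h≤ | inj₁ h<
    with final-part count c0 c+ rl uniq h (ℕₚ.≤-pred (≤-trans h< (c+ x (leaves r))))
  ... | L , final , L⊆ , eq = L , final′ , there ∘ L⊆ , eq
    where
    final′ : Final L (node (leaf x) r)
    final′ here      = inj₂ λ i → All.lookup x∉ (L⊆ i) refl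
    final′ (right p) = final p

module _ {n : ℕ} (C : Circuit n) where

  Val-step : ∀ {a a′ g} → isInput (label C g) ≡ false →
    (∀ {c} → c ∈ children C g → ∀ {b} → Val C a c b → Val C a′ c b) → ∀ {b} → Val C a g b → Val C a′ g b
  Val-step i h (v-lit p) rewrite p with () ← i
  Val-step i h (v-const p) rewrite p with () ← i
  Val-step i h (v-or1 p c v)  = v-or1 p c (h c v)
  Val-step i h (v-or0 p vs)   = v-or0 p λ c → h c (vs c)
  Val-step i h (v-and0 p c v) = v-and0 p c (h c v)
  Val-step i h (v-and1 p vs)  = v-and1 p λ c → h c (vs c)

  and-step : ∀ {a a′ c p s} → AndOf C c (p , s) → (∀ {b} → Val C a p b → Val C a′ p b) →
    (∀ {b} → Val C a s b → Val C a′ s b) → ∀ {b} → Val C a c b → Val C a′ c b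
  and-step (lab , ch) hp hs = Val-step (cong isInput lab) λ i → go (subst (_ ∈_) ch i)
    where
    go : ∀ {c} → c ∈ _ ∷ _ ∷ [] → ∀ {b} → Val C _ c b → Val C _ c b
    go (here refl)         = hp
    go (there (here refl)) = hs

  and-true : ∀ {a c p s} → AndOf C c (p , s) → Val C a c true → Val C a p true × Val C a s true
  and-true {a} {c} {p} {s} (lab , ch) v = go v refl
    where
    go : ∀ {b} → Val C a c b → b ≡ true → Val C a p true × Val C a s true
    go (v-and1 _ vs)  _ = vs (subst (p ∈_) (sym ch) (here refl)) , vs (subst (s ∈_) (sym ch) (there (here refl)))
    go (v-lit q)      _ with () ← trans (sym lab) q
    go (v-const q)    _ with () ← trans (sym lab) q
    go (v-or1 q _ _)  _ with () ← trans (sym lab) q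

  and-false : ∀ {a c p s} → AndOf C c (p , s) → Val C a c false → Val C a p true → Val C a s false
  and-false {a} {c} {p} {s} (lab , ch) v vp = go v refl
    where
    go : ∀ {b} → Val C a c b → b ≡ false → Val C a s false
    go (v-and0 _ i w) _ with subst (_ ∈_) ch i
    ... | here refl         = ⊥-elim (false≢true (Val-functional C w vp))
    ... | there (here refl) = w
    go (v-lit q)      _ with () ← trans (sym lab) q
    go (v-const q)    _ with () ← trans (sym lab) q
    go (v-or0 q _)    _ with () ← trans (sym lab) q

  SDDAt-local : ∀ {cmp T g a a′} → SDDAt C cmp T g → (∀ {x} → x ∈ leaves T → a x ≡ a′ x) →
    ∀ {b} → Val C a g b → Val C a′ g b
  SDDAt-local {a′ = a′} (sdd-lit {p = p} lab x⊑) h v = subst (Val C a′ _)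
    (trans (cong (litVal p) (sym (h (leaves-mono x⊑ (here refl))))) (Val-functional C (v-lit lab) v)) (v-lit lab)
  SDDAt-local {a′ = a′} (sdd-const lab) h v = subst (Val C a′ _) (Val-functional C (v-const lab) v) (v-const lab)
  SDDAt-local (sdd-dec l r ps lr⊑ lab ands _ primes subs _ _ _ _) h =
    Val-step (cong isInput lab) λ i → let k , and = Pointwise-∈ˡ ands i in
      and-step and
        (SDDAt-local (proj₂ (proj₂ (primes k)))
          (λ x → h (leaves-mono lr⊑ (∈-++⁺ˡ (leaves-mono (proj₁ (proj₂ (primes k))) x)))))
        (SDDAt-local (proj₂ (proj₂ (subs k)))
          (λ x → h (leaves-mono lr⊑ (∈-++⁺ʳ (leaves l) (leaves-mono (proj₁ (proj₂ (subs k))) x)))))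

  -- If the gate is true, some `∧`-gate is true, and disjointness identifies its prime with the
  -- `i`-th. If it is false, the `i`-th `∧`-gate is false although its prime is true.
  dec-select : ∀ {a g ps} → label C g ≡ ∨g → Pointwise (AndOf C) (children C g) ps →
    (∀ i j → i <ᶠ j → ∀ a → ¬ (Val C a (proj₁ (lookup ps i)) true × Val C a (proj₁ (lookup ps j)) true)) →
    ∀ i → Val C a (proj₁ (lookup ps i)) true → ∀ {b} → Val C a g b → Val C a (proj₂ (lookup ps i)) b
  dec-select lab ands disj i vp (v-or1 _ c v) with Pointwise-∈ˡ ands c
  ... | j , and with and-true and v | Finₚ.<-cmp i j
  ...   | vp′ , vs | tri≈ _ refl _ = vs
  ...   | vp′ , vs | tri< i<j _ _  = ⊥-elim (disj i j i<j _ (vp , vp′))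
  ...   | vp′ , vs | tri> _ _ j<i  = ⊥-elim (disj j i j<i _ (vp′ , vp))
  dec-select lab ands disj i vp (v-or0 _ vs) with Pointwise-lookupʳ ands i
  ... | c , c∈ , and = and-false and (vs c∈) vp
  dec-select lab _ _ _ _ (v-lit q)      with () ← trans (sym lab) q
  dec-select lab _ _ _ _ (v-const q)    with () ← trans (sym lab) q
  dec-select lab _ _ _ _ (v-and0 q _ _) with () ← trans (sym lab) q
  dec-select lab _ _ _ _ (v-and1 q _)   with () ← trans (sym lab) q

  -- What remains of a gate once the variables outside L are fixed.
  Residue : Set
  Residue = Gate C ⊎ Bool

  ResVal : Residue → Assignment n → Bool → Set
  ResVal (inj₁ g) a b = Val C a g b
  ResVal (inj₂ c) a b = b ≡ c

  ResVal-functional : ∀ ρ {a b b′} → ResVal ρ a b → ResVal ρ a b′ → b ≡ b′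
  ResVal-functional (inj₁ g) v w = Val-functional C v w
  ResVal-functional (inj₂ c) p q = trans p (sym q)

  AgreeOn AgreeOff : List (Fin n) → Assignment n → Assignment n → Set
  AgreeOn  L a a′ = ∀ x → x ∈ L → a x ≡ a′ x
  AgreeOff L a a′ = ∀ x → x ∉ L → a x ≡ a′ x

  module _ (L : List (Fin n)) where
    open import Data.List.Membership.DecPropositional (Finₚ._≟_ {n}) using (_∈?_)

    -- Follow the true primes downward. While the variable decided at a node lies outside `L`, the
    -- prime is already settled by `a` and the gate may be replaced by the selected sub. The descent
    -- stops at a gate that reads only `L`, or at a constant. The two properties say that the
    -- residue depends on `L` alone and that it is right for every completion of `a`.
    residue : ∀ {cmp T g} → RightLinear T → Final L T → SDDAt C cmp T g → ∀ a →
      ∃ λ ρ → (∀ {a a′ b} → AgreeOn L a a′ → ResVal ρ a b → ResVal ρ a′ b) ×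
              (∀ {a′ b} → AgreeOff L a a′ → Val C a′ g b → ResVal ρ a′ b)
    residue {g = g} rl final (sdd-lit {x = x} {p} lab x⊑) a with x ∈? L
    ... | yes x∈ = inj₁ g , (λ h → SDDAt-local {cmp = true} {leaf x} (sdd-lit lab here) (on h)) , λ _ v → v
      where
      on : ∀ {a a′} → AgreeOn L a a′ → ∀ {y} → y ∈ x ∷ [] → a y ≡ a′ y
      on h (here refl) = h x x∈
    ... | no x∉  = inj₂ (litVal p (a x)) , (λ _ p → p) ,
      λ h v → trans (Val-functional C v (v-lit lab)) (cong (litVal p) (sym (h x x∉)))
    residue rl final (sdd-const {b = b} lab) a = inj₂ b , (λ _ p → p) , λ _ v → Val-functional C v (v-const lab)
    residue {g = g} rl final (sdd-dec l r ps lr⊑ lab ands two primes subs sat disj cover comp) a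
      with RightLinear-⊑ lr⊑ rl
    ... | rl-node {x} rlr with final lr⊑
    ...   | inj₁ ⊆L = inj₁ g ,
      -- With `here` the gate respects its own vtree node instead of all of `T`, so locality asks
      -- for agreement on the leaves of that node only.
      (λ h → SDDAt-local (sdd-dec l r ps here lab ands two primes subs sat disj cover comp) (λ i → h _ (⊆L i))) ,
      λ _ v → v
    ...   | inj₂ x∉ with cover a
    ...     | i , vp with residue (RightLinear-⊑ (proj₁ (proj₂ (subs i))) rlr)
                            (λ p → final (⊑-trans p (⊑-trans (proj₁ (proj₂ (subs i))) (⊑-trans (right here) lr⊑))))
                            (proj₂ (proj₂ (subs i))) a
    ...       | ρ , local , correct = ρ , local , λ h v → correct h
                  (dec-select lab ands disj i (SDDAt-local (proj₂ (proj₂ (primes i))) (fixed h) vp) v)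
      where
      fixed : ∀ {a′} → AgreeOff L a a′ → ∀ {y} → y ∈ leaves (proj₁ (primes i)) → a y ≡ a′ y
      fixed h j with leaves-mono (proj₁ (proj₂ (primes i))) j
      ... | here refl = h x x∉

    -- Only the values of `a` and `a′` outside `L` count: `e` and `e′` complete these two prefixes
    -- by one common suffix.
    Distinguished : BoolFun n → Assignment n → Assignment n → Set
    Distinguished f a a′ = ∃ λ e → ∃ λ e′ → AgreeOff L a e × AgreeOff L a′ e′ × AgreeOn L e e′ × f e ≢ f e′

    -- Distinguished assignments leave different residues.
    fooling-set : ∀ {cmp T f} → RightLinear T → Final L T → SDDAt C cmp T (output C) → Computes C f →
      ∀ {N} (α : Fin N → Assignment n) → (∀ {i j} → i ≢ j → Distinguished f (α i) (α j)) →
      N ≤ suc (m C) + 2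
    fooling-set {f = f} rl final sdd comp α dist = injective⇒≤ {f = encode ∘ ρ} λ eq →
      inj (trans (sym (decode-encode _)) (trans (cong decode eq) (decode-encode _)))
      where
      ρ : ∀ i → Residue
      ρ i = proj₁ (residue rl final sdd (α i))

      encode : Residue → Fin (suc (m C) + 2)
      encode = join (suc (m C)) 2 ∘ Sum.map₂ (Inverse.from 2↔Bool)

      decode : Fin (suc (m C) + 2) → Residue
      decode = Sum.map₂ (Inverse.to 2↔Bool) ∘ splitAt (suc (m C))

      decode-encode : ∀ r → decode (encode r) ≡ r
      decode-encode r with r | splitAt-join (suc (m C)) 2 (Sum.map₂ (Inverse.from 2↔Bool) r)
      ... | inj₁ g     | eq = cong (Sum.map₂ (Inverse.to 2↔Bool)) eq
      ... | inj₂ true  | eq = cong (Sum.map₂ (Inverse.to 2↔Bool)) eq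
      ... | inj₂ false | eq = cong (Sum.map₂ (Inverse.to 2↔Bool)) eq

      inj : ∀ {i j} → ρ i ≡ ρ j → i ≡ j
      inj {i} {j} eq with i Finₚ.≟ j
      ... | yes p = p
      ... | no ¬p with dist ¬p
      ...   | e , e′ , off , off′ , on , f≢ = ⊥-elim (f≢ (ResVal-functional (ρ j)
        (proj₁ (proj₂ (residue rl final sdd (α j))) on
          (subst (λ r → ResVal r e (f e)) eq (proj₂ (proj₂ (residue rl final sdd (α i))) off (comp e))))
        (proj₂ (proj₂ (residue rl final sdd (α j))) off′ (comp e′))))

-- Latin squares and averaging

-- The triples with i + j + l + 1 ≡ 0 mod k form a totally symmetric latin square.
Triple : ∀ {k} → Fin k → Fin k → Fin k → Set
Triple {k} i j l = suc (toℕ i + toℕ j + toℕ l) ≡ k ⊎ suc (toℕ i + toℕ j + toℕ l) ≡ k + k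

Triple-unique : ∀ {k} {i j l l′ : Fin k} → Triple i j l → Triple i j l′ → l ≡ l′
Triple-unique {k} {i} {j} {l} {l′} t t′ = toℕ-injective (go t t′)
  where
  s = toℕ i + toℕ j
  wrap : ∀ {x y} → x < k → suc (s + y) ≡ k → suc (s + x) ≡ k + k → ⊥
  wrap {x} {y} x<k p q = ℕₚ.<-irrefl q (ℕₚ.+-mono-≤-< (≤-trans (ℕₚ.m≤m+n (suc s) y) (≤-reflexive p)) x<k)
  go : Triple i j l → Triple i j l′ → toℕ l ≡ toℕ l′
  go (inj₁ p) (inj₁ q) = ℕₚ.+-cancelˡ-≡ (suc s) _ _ (trans p (sym q))
  go (inj₂ p) (inj₂ q) = ℕₚ.+-cancelˡ-≡ (suc s) _ _ (trans p (sym q))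
  go (inj₁ p) (inj₂ q) = ⊥-elim (wrap (toℕ<n l′) p q)
  go (inj₂ p) (inj₁ q) = ⊥-elim (wrap (toℕ<n l) q p)

-- The sum with its extra 1 lies strictly between 0 and 3k, so `k` and `k + k` are the only
-- multiples to consider; without the 1, the sum 0 would be a third case.
third∃ : ∀ {k} (i j : Fin k) → ∃ (Triple i j)
third∃ {k} i j with suc (toℕ i + toℕ j) ≤? k
... | yes p = fromℕ< l< , inj₁ (trans (cong (suc (toℕ i + toℕ j) +_) (toℕ-fromℕ< l<)) (ℕₚ.m+[n∸m]≡n p))
  where
  l< : k ∸ suc (toℕ i + toℕ j) < k
  l< = ℕₚ.∸-monoʳ-< (s≤s z≤n) p
... | no ¬p = fromℕ< l< , inj₂ (trans (cong (suc (toℕ i + toℕ j) +_) (toℕ-fromℕ< l<))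
    (ℕₚ.m+[n∸m]≡n (+-mono-≤ (toℕ<n i) (ℕₚ.<⇒≤ (toℕ<n j)))))
  where
  l< : k + k ∸ suc (toℕ i + toℕ j) < k
  l< = subst (k + k ∸ suc (toℕ i + toℕ j) <_) (ℕₚ.m+n∸m≡n k k)
    (ℕₚ.∸-monoʳ-< (ℕₚ.≰⇒> ¬p) (+-mono-≤ (toℕ<n i) (ℕₚ.<⇒≤ (toℕ<n j))))

third : ∀ {k} → Fin k → Fin k → Fin k
third i j = proj₁ (third∃ i j)

third-involutive : ∀ {k} (i j : Fin k) → third i (third i j) ≡ j
third-involutive {k} i j = Triple-unique {i = i} {third i j} (proj₂ (third∃ i (third i j))) (swap (proj₂ (third∃ i j)))
  where
  eq : ∀ a b c → a + b + c ≡ a + c + b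
  eq a b c = trans (+-assoc a b c) (trans (cong (a +_) (+-comm b c)) (sym (+-assoc a c b)))
  swap : Triple i j (third i j) → Triple i (third i j) j
  swap (inj₁ p) = inj₁ (trans (cong suc (eq (toℕ i) _ _)) p)
  swap (inj₂ p) = inj₂ (trans (cong suc (eq (toℕ i) _ _)) p)

third-comm : ∀ {k} (i j : Fin k) → third i j ≡ third j i
third-comm {k} i j = Triple-unique {i = i} {j} (proj₂ (third∃ i j)) (swap (proj₂ (third∃ j i)))
  where
  swap : ∀ {l} → Triple j i l → Triple i j l
  swap {l} (inj₁ p) = inj₁ (trans (cong (λ s → suc (s + toℕ l)) (+-comm (toℕ i) (toℕ j))) p)
  swap {l} (inj₂ p) = inj₂ (trans (cong (λ s → suc (s + toℕ l)) (+-comm (toℕ i) (toℕ j))) p)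

third-injective : ∀ {k} (i : Fin k) {j j′} → third i j ≡ third i j′ → j ≡ j′
third-injective i {j} {j′} eq =
  trans (sym (third-involutive i j)) (trans (cong (third i) eq) (third-involutive i j′))

-- The way back from a datum to the key that points to it: by total symmetry both directions are the
-- same function.
third-inverse : ∀ {k} (i j : Fin k) → third (third i j) j ≡ i
third-inverse i j = trans (third-comm (third i j) j)
  (trans (cong (third j) (third-comm i j)) (third-involutive j i))

indicator : Bool → ℕ
indicator b = if b then 1 else 0

count : ∀ {k} → (Fin k → Bool) → ℕ
count P = ∑ (indicator ∘ P)

indicator-∧ : ∀ a b → indicator (a ∧ b) ≡ indicator a * indicator b
indicator-∧ true  b = sym (ℕₚ.+-identityʳ (indicator b))
indicator-∧ false b = refl

-- Double counting: for fixed `j` the map `third j` permutes the indices, so each pair from `P` and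
-- `Q` occurs for exactly one `l`.
count-thirds : ∀ {k} (P Q : Fin k → Bool) →
  ∑ (λ l → count (λ j → P j ∧ Q (third j l))) ≡ count P * count Q
count-thirds P Q = begin
  ∑ (λ l → ∑ (λ j → indicator (P j ∧ Q (third j l))))              ≡⟨ Sumₚ.∑-comm (λ l j → indicator (P j ∧ Q (third j l))) ⟩
  ∑ (λ j → ∑ (λ l → indicator (P j ∧ Q (third j l))))              ≡⟨ Sumₚ.sum-cong-≗ row ⟩
  ∑ (λ j → indicator (P j) * count Q)                              ≡⟨ sym (*-distribʳ-sum (count Q) (indicator ∘ P)) ⟩
  count P * count Q                                                ∎
  where
  open ≡-Reasoning
  row : ∀ j → ∑ (λ l → indicator (P j ∧ Q (third j l))) ≡ indicator (P j) * count Q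
  row j = begin
    ∑ (λ l → indicator (P j ∧ Q (third j l)))              ≡⟨ Sumₚ.sum-cong-≗ (λ l → indicator-∧ (P j) (Q (third j l))) ⟩
    ∑ (λ l → indicator (P j) * indicator (Q (third j l)))  ≡⟨ sym (*-distribˡ-sum (indicator (P j)) (λ l → indicator (Q (third j l)))) ⟩
    indicator (P j) * ∑ (λ l → indicator (Q (third j l)))  ≡⟨ cong (indicator (P j) *_) (sym (Sumₚ.sum-permute (indicator ∘ Q)
                                                                (permutation (third j) (third j) (third-involutive j) (third-involutive j)))) ⟩
    indicator (P j) * count Q                              ∎

average : ∀ {k} (g : Fin k → ℕ) {t} → 1 ≤ k → k * t ≤ ∑ g → ∃ λ i → t ≤ g i
average {k} g {t} 1≤k h with any? (λ i → t ≤? g i)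
... | yes w = w
... | no ¬w = ⊥-elim (ℕₚ.<-irrefl refl (≤-trans (ℕₚ.+-monoˡ-≤ (k * t) 1≤k)
      (≤-trans (ℕₚ.+-monoʳ-≤ k h) (small g λ i → ℕₚ.≰⇒> λ le → ¬w (i , le)))))
  where
  small : ∀ {k} (g : Fin k → ℕ) → (∀ i → g i < t) → k + ∑ g ≤ k * t
  small {zero}  g lt = z≤n
  small {suc k} g lt = ≤-trans (≤-reflexive (cong suc (move k (g zero) (∑ (g ∘ suc)))))
    (+-mono-≤ (lt zero) (small (g ∘ suc) (lt ∘ suc)))
    where
    move : ∀ a b c → a + (b + c) ≡ b + (a + c)
    move a b c = trans (sym (+-assoc a b c)) (trans (cong (_+ c) (+-comm a b)) (+-assoc b a c))

count-embed : ∀ {k} (P : Fin k → Bool) {t} → t ≤ count P →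
  ∃ λ (e : Fin t → Fin k) → (∀ {p q} → e p ≡ e q → p ≡ q) × ∀ q → P (e q) ≡ true
count-embed {k}     P {zero}  h = (λ ()) , (λ { {()} }) , λ ()
count-embed {suc k} P {suc t} h with P zero in P0
... | true with count-embed (P ∘ suc) (ℕₚ.≤-pred h)
...   | e , inj , Pe = e′ , inj′ , Pe′
  where
  e′ : Fin (suc t) → Fin (suc k)
  e′ zero    = zero
  e′ (suc q) = suc (e q)
  inj′ : ∀ {p q} → e′ p ≡ e′ q → p ≡ q
  inj′ {zero}  {zero}  _  = refl
  inj′ {suc p} {suc q} eq = cong suc (inj (Finₚ.suc-injective eq))
  Pe′ : ∀ q → P (e′ q) ≡ true
  Pe′ zero    = P0
  Pe′ (suc q) = Pe q
count-embed {suc k} P {suc t} h | false with count-embed (P ∘ suc) h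
...   | e , inj , Pe = suc ∘ e , inj ∘ Finₚ.suc-injective , Pe

count-complement : ∀ {k} (P : Fin k → Bool) → count P + count (not ∘ P) ≡ k
count-complement {zero}  P = refl
count-complement {suc k} P with P zero
... | true  = cong suc (count-complement (P ∘ suc))
... | false = trans (ℕₚ.+-suc (count (P ∘ suc)) _) (cong suc (count-complement (P ∘ suc)))

count-none : ∀ {k} (P : Fin k → Bool) → (∀ i → P i ≡ false) → count P ≡ 0
count-none {zero}  P h = refl
count-none {suc k} P h rewrite h zero = count-none (P ∘ suc) (h ∘ suc)

count-all : ∀ {k} (P : Fin k → Bool) → (∀ i → P i ≡ true) → count P ≡ k
count-all {zero}  P h = refl
count-all {suc k} P h rewrite h zero = cong suc (count-all (P ∘ suc) (h ∘ suc))

count-insert : ∀ {k} (P Q R : Fin k → Bool) → (∀ i → P i ≡ true → R i ≡ true ⊎ Q i ≡ true) →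
  (∀ {i j} → R i ≡ true → R j ≡ true → i ≡ j) → count P ≤ suc (count Q)
count-insert P Q R h R-unique = ≤-trans (cover P Q R h) (ℕₚ.+-monoˡ-≤ (count Q) at-most-one)
  where
  cover : ∀ {k} (P Q R : Fin k → Bool) → (∀ i → P i ≡ true → R i ≡ true ⊎ Q i ≡ true) →
    count P ≤ count R + count Q
  cover {zero}  P Q R h = z≤n
  cover {suc k} P Q R h = ≤-trans (+-mono-≤ (one (P zero) (Q zero) (R zero) (h zero)) (cover (P ∘ suc) (Q ∘ suc) (R ∘ suc) (h ∘ suc)))
    (≤-reflexive (interchange (indicator (R zero)) (indicator (Q zero)) (count (R ∘ suc)) (count (Q ∘ suc))))
    where
    one : ∀ p q r → (p ≡ true → r ≡ true ⊎ q ≡ true) → indicator p ≤ indicator r + indicator q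
    one false _ _ _ = z≤n
    one true q r h with h refl
    ... | inj₁ refl = s≤s z≤n
    ... | inj₂ refl = ℕₚ.m≤n+m 1 (indicator r)
    interchange : ∀ a b c d → (a + b) + (c + d) ≡ (a + c) + (b + d)
    interchange = solve-∀
  at-most-one : count R ≤ 1
  at-most-one with count R ≤? 1
  ... | yes le = le
  ... | no ¬le with count-embed R {2} (ℕₚ.≰⇒> ¬le)
  ...   | e , inj , Re with () ← inj {zero} {suc zero} (R-unique (Re zero) (Re (suc zero)))

-- The hard functions

-- roles ρ p d assigns p to the keys and d to the data of role ρ.
roles : ∀ {A : Set} → Bool → A → A → Bool → A
roles true  p d true  = p
roles true  p d false = d
roles false p d true  = d
roles false p d false = p

roles-key : ∀ {A : Set} ρ {p d : A} → roles ρ p d ρ ≡ p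
roles-key true  = refl
roles-key false = refl

roles-data : ∀ {A : Set} ρ {p d : A} → roles ρ p d (not ρ) ≡ d
roles-data true  = refl
roles-data false = refl

module Hard (k : ℕ) where

  dim : ℕ
  dim = 4 * (2 + k)

  -- The variables form four rows of length 2 + k; column 0 is padding.
  var : Fin 4 → Fin (2 + k) → Fin dim
  var = combine

  role : Fin dim
  role = var 0F 1F

  address y : Fin k → Fin dim
  address i = var 0F (suc (suc i))
  y i       = var 3F (suc (suc i))

  row : Bool → Fin 4
  row false = 1F
  row true  = 2F

  x : Bool → Fin k → Fin dim
  x σ i = var (row σ) (suc (suc i))

  module Inner (ρ : Bool) (c : Fin k) = Selector (x ρ) (λ i → x (not ρ) (third i c))
  module Outer = Selector address (λ _ → role)

  leafBranch : Code k → BoolFun dim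
  leafBranch nothing        a = true
  leafBranch (just (i , b)) a = litVal b (a (y i))

  -- With i the first true key of role ρ and j = third i c: whether datum j equals y i.
  inner : Bool → Fin k → BoolFun dim
  inner ρ c a = leafBranch (Inner.select ρ c a) a

  innerBranch : Code k → BoolFun dim
  innerBranch nothing        a = true
  innerBranch (just (c , ρ)) a = inner ρ c a

  hard : BoolFun dim
  hard a = innerBranch (Outer.select a) a

  inner-first : ∀ ρ c {a i} → first (a ∘ x ρ) ≡ just i → inner ρ c a ≡ litVal (a (x (not ρ) (third i c))) (a (y i))
  inner-first ρ c {a} eq = cong (λ code → leafBranch code a) (Inner.select-just ρ c a eq)

  inner-nothing : ∀ ρ c {a} → first (a ∘ x ρ) ≡ nothing → inner ρ c a ≡ true
  inner-nothing ρ c {a} eq = cong (λ code → leafBranch code a) (Inner.select-nothing ρ c a eq)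

  hard-first : ∀ {a c} → first (a ∘ address) ≡ just c → hard a ≡ inner (a role) c a
  hard-first {a} eq = cong (λ code → innerBranch code a) (Outer.select-just a eq)

  module _ (r : Bool) (w : Fin k → Bool) (u : Bool → Fin k → Bool) (v : Fin k → Bool) where

    entry : Fin 4 → Fin (2 + k) → Bool
    entry 0F 1F            = r
    entry 0F (suc (suc i)) = w i
    entry 1F (suc (suc i)) = u false i
    entry 2F (suc (suc i)) = u true i
    entry 3F (suc (suc i)) = v i
    entry _  _             = false

    assign : Assignment dim
    assign z = uncurry entry (remQuot (2 + k) z)

    assign-var : ∀ g i → assign (var g i) ≡ entry g i
    assign-var g i = cong (uncurry entry) (remQuot-combine g i)

    assign-x : ∀ σ i → assign (x σ i) ≡ u σ i
    assign-x false i = assign-var 1F (suc (suc i))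
    assign-x true  i = assign-var 2F (suc (suc i))

    assign-keys : ∀ ρ {p} → u ρ ≡ p → first (assign ∘ x ρ) ≡ first p
    assign-keys ρ refl = first-cong (assign-x ρ)

    assign-inner : ∀ ρ c {i} → u ρ ≡ single i → inner ρ c assign ≡ litVal (u (not ρ) (third i c)) (v i)
    assign-inner ρ c {i} eq =
      trans (inner-first ρ c {a = assign} {i} (trans (assign-keys ρ eq) (first-single i)))
            (cong₂ litVal (assign-x (not ρ) (third i c)) (assign-var 3F (suc (suc i))))

    assign-inner-none : ∀ ρ c → u ρ ≡ (λ _ → false) → inner ρ c assign ≡ true
    assign-inner-none ρ c eq = inner-nothing ρ c (trans (assign-keys ρ eq) (first-none k))

    assign-hard : ∀ {c} → w ≡ single c → hard assign ≡ inner r c assign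
    assign-hard {c} refl = trans (hard-first {assign} {c}
      (trans (first-cong (λ i → assign-var 0F (suc (suc i)))) (first-single c)))
      (cong (λ ρ → inner ρ c assign) (assign-var 0F 1F))

  -- `P` is the set on which agreement is wanted: inside `L`, outside `L`, or the leaves of a vtree.
  assign-x-cong : ∀ {r w u u′ v} (P : Fin dim → Set) → (∀ σ i → P (x σ i) → u σ i ≡ u′ σ i) →
    ∀ z → P z → assign r w u v z ≡ assign r w u′ v z
  assign-x-cong {r} {w} {u} {u′} {v} P h z Pz = go (proj₁ cell) (proj₂ cell)
    (subst P (sym (combine-remQuot {4} (2 + k) z)) Pz)
    where
    cell = remQuot {4} (2 + k) z
    go : ∀ g i → P (var g i) → entry r w u v g i ≡ entry r w u′ v g i
    go 1F (suc (suc i)) p = h false i p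
    go 2F (suc (suc i)) p = h true i p
    go 0F 0F            _ = refl
    go 0F 1F            _ = refl
    go 0F (suc (suc i)) _ = refl
    go 1F 0F            _ = refl
    go 1F 1F            _ = refl
    go 2F 0F            _ = refl
    go 2F 1F            _ = refl
    go 3F 0F            _ = refl
    go 3F 1F            _ = refl
    go 3F (suc (suc i)) _ = refl

  -- Witnesses for satisfiable primes and distinct subs

  none all : Fin k → Bool
  none _ = false
  all  _ = true

  -- All data receive the same bit `b`, so one witness serves every shift `c`.
  innerWitness : Bool → Code k → Assignment dim
  innerWitness ρ nothing        = assign true none (λ _ → none) none
  innerWitness ρ (just (i , b)) = assign true none (roles ρ (single i) (λ _ → b)) none

  innerWitness-select : ∀ ρ c code → Inner.select ρ c (innerWitness ρ code) ≡ code
  innerWitness-select ρ c nothing =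
    Inner.select-nothing ρ c (innerWitness ρ nothing) (trans (assign-keys true none (λ _ → none) none ρ refl) (first-none k))
  innerWitness-select ρ c (just (i , b)) = trans
    (Inner.select-just ρ c (innerWitness ρ (just (i , b))) (trans (assign-keys true none u none ρ (roles-key ρ)) (first-single i)))
    (cong (λ b → just (i , b)) (trans (assign-x true none u none (not ρ) (third i c))
      (cong (λ d → d (third i c)) (roles-data ρ {single i}))))
    where u = roles ρ (single i) (λ _ → b)

  outerWitness : Code k → Assignment dim
  outerWitness nothing        = assign true none (λ _ → none) none
  outerWitness (just (c , ρ)) = assign ρ (single c) (λ _ → none) none

  outerWitness-select : ∀ code → Outer.select (outerWitness code) ≡ code
  outerWitness-select nothing = Outer.select-nothing (outerWitness nothing)
    (trans (first-cong (λ i → assign-var true none (λ _ → none) none 0F (suc (suc i)))) (first-none k))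
  outerWitness-select (just (c , ρ)) = trans
    (Outer.select-just (outerWitness (just (c , ρ)))
      (trans (first-cong (λ i → assign-var ρ (single c) (λ _ → none) none 0F (suc (suc i)))) (first-single c)))
    (cong (λ b → just (c , b)) (assign-var ρ (single c) (λ _ → none) none 0F 1F))

  litVal-complement : ∀ b → litVal b (not b) ≡ false
  litVal-complement true  = refl
  litVal-complement false = refl

  -- With every `y` true, the comparison returns the datum itself.
  hard-assign : ∀ ρ c i d → hard (assign ρ (single c) (roles ρ (single i) d) all) ≡ d (third i c)
  hard-assign ρ c i d = begin
    hard a                                  ≡⟨ assign-hard ρ (single c) u all refl ⟩
    inner ρ c a                             ≡⟨ assign-inner ρ (single c) u all ρ c (roles-key ρ) ⟩
    litVal (u (not ρ) (third i c)) true     ≡⟨ cong (λ d → litVal (d (third i c)) true) (roles-data ρ {single i}) ⟩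
    litVal (d (third i c)) true             ≡⟨ litVal-to-true (d (third i c)) ⟩
    d (third i c)                           ∎
    where
    open ≡-Reasoning
    u = roles ρ (single i) d
    a = assign ρ (single c) u all
    litVal-to-true : ∀ b → litVal b true ≡ b
    litVal-to-true true  = refl
    litVal-to-true false = refl

  leafBranch-separated : ∀ {c c′} → c ≢ c′ → ∃ λ a → leafBranch c′ a ≡ not (leafBranch c a)
  leafBranch-separated {nothing}      {nothing}        c≢ = ⊥-elim (c≢ refl)
  leafBranch-separated {nothing}      {just (i , b)}   _  = (λ _ → not b) , litVal-complement b
  leafBranch-separated {just (i , b)} {nothing}        _  = (λ _ → not b) , cong not (sym (litVal-complement b))
  leafBranch-separated {just (i , b)} {just (i′ , b′)} c≢ with i Finₚ.≟ i′
  ... | yes refl = (λ _ → true) , trans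
      (cong (λ b → litVal b true) (¬-not {b′} {b} λ { refl → c≢ refl }))
      (litVal-not b true)
  ... | no i≢ = assign true none (λ _ → none) v , trans
      (trans (cong (litVal b′) (trans (at i′) (cong (if_then b else not b′) (dec-false (i Finₚ.≟ i′) i≢)))) (litVal-complement b′))
      (cong not (sym (trans (cong (litVal b) (trans (at i) (cong (if_then b else not b′) (dec-true (i Finₚ.≟ i) refl)))) (litVal-refl b))))
    where
    -- Chosen to make the literal of `i` true and that of `i′` false.
    v : Fin k → Bool
    v j = if single i j then b else not b′
    at : ∀ j → assign true none (λ _ → none) v (y j) ≡ v j
    at j = assign-var true none (λ _ → none) v 3F (suc (suc j))

  -- One true key, all data false and every `y` true. The key sits at index `c` because some element
  -- of `Fin k` is needed and `c` is at hand.
  inner-false : ∀ ρ c → ∃ λ a → inner ρ c a ≡ false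
  inner-false ρ c = assign true none u all , trans (assign-inner true none u all ρ c (roles-key ρ))
    (cong (λ d → litVal (d (third c c)) true) (roles-data ρ {single c}))
    where u = roles ρ (single c) none

  innerBranch-separated : ∀ {c c′} → c ≢ c′ → ∃ λ a → innerBranch c′ a ≡ not (innerBranch c a)
  innerBranch-separated {nothing}      {nothing}        c≢ = ⊥-elim (c≢ refl)
  innerBranch-separated {nothing}      {just (c , ρ)}   _  = inner-false ρ c
  innerBranch-separated {just (c , ρ)} {nothing}        _  with inner-false ρ c
  ... | a , eq = a , cong not (sym eq)
  innerBranch-separated {just (c , ρ)} {just (c′ , ρ′)} c≢ with ρ Bool.≟ ρ′
  -- Different roles: the block that `ρ′` reads as keys is empty, giving true, while `ρ` finds a key
  -- whose datum is false.
  ... | no ρ≢ = assign true none u all , trans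
      (assign-inner-none true none u all ρ′ c′ (subst (λ σ → u σ ≡ none) (sym (¬-not (ρ≢ ∘ sym))) (roles-data ρ {single c})))
      (cong not (sym (trans (assign-inner true none u all ρ c (roles-key ρ))
        (cong (λ d → litVal (d (third c c)) true) (roles-data ρ {single c})))))
    where u = roles ρ (single c) none
  -- Same role, different shifts: the only true datum is the one that key `c` points to under `c′`;
  -- under `c` the key points elsewhere.
  ... | yes refl = assign true none u all , trans
      (trans (assign-inner true none u all ρ c′ (roles-key ρ)) (trans
        (cong (λ d → litVal (d (third c c′)) true) (roles-data ρ {single c}))
        (cong (λ b → litVal b true) (dec-true (third c c′ Finₚ.≟ third c c′) refl))))
      (cong not (sym (trans (assign-inner true none u all ρ c (roles-key ρ)) (trans
        (cong (λ d → litVal (d (third c c)) true) (roles-data ρ {single c}))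
        (cong (λ b → litVal b true) (dec-false (third c c′ Finₚ.≟ third c c)
          λ eq → c≢ (cong (λ c → just (c , ρ)) (sym (third-injective c eq)))))))))
    where u = roles ρ (single c) (single (third c c′))

  -- The vtree and the cubic upper bound

  rowVars : Fin 4 → List (Fin dim)
  rowVars g = map (var g ∘ suc) (allFin (suc k))

  ∈-rowVars : ∀ g i → var g (suc i) ∈ rowVars g
  ∈-rowVars g i = ∈-map⁺ (var g ∘ suc) (∈-allFin i)

  addressVars dataVars yVars : List (Fin dim)
  addressVars = rowVars 0F
  dataVars    = rowVars 1F ++ rowVars 2F
  yVars       = rowVars 3F

  x∈dataVars : ∀ σ i → x σ i ∈ dataVars
  x∈dataVars false i = ∈-++⁺ˡ (∈-rowVars 1F (suc i))
  x∈dataVars true  i = ∈-++⁺ʳ (rowVars 1F) (∈-rowVars 2F (suc i))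

  -- Both blocks lie below the same left child, since an inner prime reads keys in one and a datum
  -- in the other, in either role.
  yTree innerTree hardTree : VTree dim
  yTree     = rightLinear yVars (var 3F zero)
  innerTree = node (rightLinear dataVars (var 1F zero)) yTree
  hardTree  = node (rightLinear addressVars (var 0F zero)) innerTree

  innerSize hardSize : ℕ
  innerSize = suc (k * 2) * (3 + (6 * length dataVars + 0))
  hardSize  = suc (k * 2) * (3 + (6 * length addressVars + innerSize))

  ∈-rightLinear : ∀ {n} {v : Fin n} {xs z} → v ∈ xs → leaf v ⊑ rightLinear xs z
  ∈-rightLinear (here refl) = left here
  ∈-rightLinear (there i)   = right (∈-rightLinear i)

  leafBranchSdd : ∀ c → Sdd yTree (leafBranch c) 0
  leafBranchSdd nothing        = sdd-const true λ _ → refl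
  leafBranchSdd (just (i , b)) = sdd-lit (y i) b (∈-rightLinear (∈-rowVars 3F (suc i))) λ _ → refl

  innerSdd : 1 ≤ k → ∀ ρ c → Sdd innerTree (inner ρ c) innerSize
  innerSdd 1≤k ρ c = Inner.selectorSdd ρ c dataVars (var 1F zero) (x∈dataVars ρ) (λ i → x∈dataVars (not ρ) (third i c))
    (innerWitness ρ) (innerWitness-select ρ c) leafBranch leafBranchSdd leafBranch-separated 1≤k

  innerBranchSdd : 1 ≤ k → ∀ c → Sdd innerTree (innerBranch c) innerSize
  innerBranchSdd 1≤k nothing        = sdd-const true λ _ → refl
  innerBranchSdd 1≤k (just (c , ρ)) = innerSdd 1≤k ρ c

  hardSdd : 1 ≤ k → Sdd hardTree hard hardSize
  hardSdd 1≤k = Outer.selectorSdd addressVars (var 0F zero) (λ i → ∈-rowVars 0F (suc i)) (λ _ → ∈-rowVars 0F zero)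
    outerWitness outerWitness-select innerBranch (innerBranchSdd 1≤k) innerBranch-separated 1≤k

  hardTree-isVtree : IsVtree hardTree
  hardTree-isVtree = Uniqueₚ.++⁺ (block (rowVars-unique 0F) (pad∉ 0F 0F))
      (Uniqueₚ.++⁺ (block data-unique data-pad∉) (block (rowVars-unique 3F) (pad∉ 3F 3F)) inner-disjoint)
      outer-disjoint
    where
    rowOf : Fin dim → Fin 4
    rowOf = proj₁ ∘ remQuot {4} (2 + k)

    rowOf-var : ∀ g i → rowOf (var g i) ≡ g
    rowOf-var g i = cong proj₁ (remQuot-combine g i)

    rowOf-row : ∀ g {v} → v ∈ rowVars g → rowOf v ≡ g
    rowOf-row g p with ∈-map⁻ (var g ∘ suc) p
    ... | i , _ , refl = rowOf-var g (suc i)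

    ∈-block : ∀ {n} xs {z : Fin n} {v} → v ∈ leaves (rightLinear xs z) → v ∈ xs ⊎ v ≡ z
    ∈-block xs {z} p with ∈-++⁻ xs (subst (_ ∈_) (leaves-rightLinear xs z) p)
    ... | inj₁ q           = inj₁ q
    ... | inj₂ (here refl) = inj₂ refl

    block : ∀ {n} {xs} {z : Fin n} → Unique xs → z ∉ xs → Unique (leaves (rightLinear xs z))
    block {xs = xs} {z} u z∉ = subst Unique (sym (leaves-rightLinear xs z))
      (Uniqueₚ.++⁺ u ([] ∷ []) λ { (p , here refl) → z∉ p })

    pad∉ : ∀ g h → var g zero ∉ rowVars h
    pad∉ g h p with ∈-map⁻ (var h ∘ suc) p
    ... | i , _ , eq with () ← Finₚ.combine-injectiveʳ g zero h (suc i) eq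

    rowVars-unique : ∀ g → Unique (rowVars g)
    rowVars-unique g = Uniqueₚ.map⁺
      (λ {i} {j} eq → Finₚ.suc-injective (Finₚ.combine-injectiveʳ g (suc i) g (suc j) eq)) (Uniqueₚ.allFin⁺ (suc k))

    data-unique : Unique dataVars
    data-unique = Uniqueₚ.++⁺ (rowVars-unique 1F) (rowVars-unique 2F) λ { (p , q) →
      case trans (sym (rowOf-row 1F p)) (rowOf-row 2F q) of λ () }

    data-pad∉ : var 1F zero ∉ dataVars
    data-pad∉ p with ∈-++⁻ (rowVars 1F) p
    ... | inj₁ q = pad∉ 1F 1F q
    ... | inj₂ q = pad∉ 1F 2F q

    rowOf-block : ∀ g {v} → v ∈ leaves (rightLinear (rowVars g) (var g zero)) → rowOf v ≡ g
    rowOf-block g p with ∈-block (rowVars g) p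
    ... | inj₁ q    = rowOf-row g q
    ... | inj₂ refl = rowOf-var g zero

    rowOf-data : ∀ {v} → v ∈ leaves (rightLinear dataVars (var 1F zero)) → rowOf v ≡ 1F ⊎ rowOf v ≡ 2F
    rowOf-data p with ∈-block dataVars p
    ... | inj₂ refl = inj₁ (rowOf-var 1F zero)
    ... | inj₁ q with ∈-++⁻ (rowVars 1F) q
    ...   | inj₁ r = inj₁ (rowOf-row 1F r)
    ...   | inj₂ r = inj₂ (rowOf-row 2F r)

    inner-disjoint : ∀ {v} → ¬ (v ∈ leaves (rightLinear dataVars (var 1F zero)) × v ∈ leaves yTree)
    inner-disjoint (p , q) with rowOf-data p | rowOf-block 3F q
    ... | inj₁ e | e′ = case trans (sym e) e′ of λ ()
    ... | inj₂ e | e′ = case trans (sym e) e′ of λ ()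

    outer-disjoint : ∀ {v} → ¬ (v ∈ leaves (rightLinear addressVars (var 0F zero)) × v ∈ leaves innerTree)
    outer-disjoint (p , q) with rowOf-block 0F p | ∈-++⁻ (leaves (rightLinear dataVars (var 1F zero))) q
    ... | e | inj₂ r = case trans (sym e) (rowOf-block 3F r) of λ ()
    ... | e | inj₁ r with rowOf-data r
    ...   | inj₁ e′ = case trans (sym e) e′ of λ ()
    ...   | inj₂ e′ = case trans (sym e) e′ of λ ()

  length-rowVars : ∀ g → length (rowVars g) ≡ suc k
  length-rowVars g = trans (length-map (var g ∘ suc) (allFin (suc k))) (length-tabulate {n = suc k} (λ i → i))

  hardSize≤ : hardSize ≤ dim ^ 3
  hardSize≤ = subst₂ (λ a d → total a d ≤ dim ^ 3)
    (sym (length-rowVars 0F))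
    (sym (trans (length-++ (rowVars 1F)) (cong₂ _+_ (length-rowVars 1F) (length-rowVars 2F))))
    (≤-trans (ℕₚ.m≤m+n (total (suc k) (suc k + suc k)) _) (≤-reflexive (slack k)))
    where
    total : ℕ → ℕ → ℕ
    total a d = suc (k * 2) * (3 + (6 * a + suc (k * 2) * (3 + (6 * d + 0))))
    -- The summand with explicit coefficients is the difference of the two sides, a polynomial
    -- without negative terms.
    slack : ∀ k → suc (k * 2) * (3 + (6 * suc k + suc (k * 2) * (3 + (6 * (suc k + suc k) + 0))))
                    + (488 + 672 * k + 264 * (k * k) + 16 * (k * k * k))
                  ≡ (4 * (2 + k)) * ((4 * (2 + k)) * ((4 * (2 + k)) * 1))
    slack = solve-∀

-- The OBDD lower bound

does-true : ∀ {P : Set} (d : Dec P) → does d ≡ true → P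
does-true (yes p) _ = p

does-false : ∀ {P : Set} (d : Dec P) → not (does d) ≡ true → ¬ P
does-false (no ¬p) _ = ¬p

∧-true : ∀ {a b} → a ∧ b ≡ true → a ≡ true × b ≡ true
∧-true {true} eq = refl , eq

roles-cong : ∀ {A B : Set} ρ {p p′ d d′ : A → B} σ i → (σ ≡ ρ → p i ≡ p′ i) → (σ ≡ not ρ → d i ≡ d′ i) →
  roles ρ p d σ i ≡ roles ρ p′ d′ σ i
roles-cong true  true  i hp hd = hp refl
roles-cong true  false i hp hd = hd refl
roles-cong false true  i hp hd = hd refl
roles-cong false false i hp hd = hp refl

bits : ∀ t → Fin (2 ^ t) → Fin t → Bool
bits t n q = Inverse.to 2↔Bool (finToFun n q)

bits-differ : ∀ t {n n′ : Fin (2 ^ t)} → n ≢ n′ → ∃ λ q → bits t n q ≢ bits t n′ q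
bits-differ t {n} {n′} n≢ with any? (λ q → ¬? (bits t n q Bool.≟ bits t n′ q))
... | yes w = w
... | no ¬w = ⊥-elim (n≢ (trans (sym (funToFin-finToFin {t} {2} n))
    (trans (funToFin-cong same) (funToFin-finToFin {t} {2} n′))))
  where
  funToFin-cong : ∀ {m n} {f g : Fin m → Fin n} → (∀ i → f i ≡ g i) → funToFin f ≡ funToFin g
  funToFin-cong {zero}  h = refl
  funToFin-cong {suc m} h = cong₂ combine (h zero) (funToFin-cong (h ∘ suc))
  to-injective : ∀ {a b} → Inverse.to 2↔Bool a ≡ Inverse.to 2↔Bool b → a ≡ b
  to-injective {a} {b} eq = trans (sym (Inverse.strictlyInverseʳ 2↔Bool a))
    (trans (cong (Inverse.from 2↔Bool) eq) (Inverse.strictlyInverseʳ 2↔Bool b))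
  same : ∀ q → finToFun n q ≡ finToFun n′ q
  same q with bits t n q Bool.≟ bits t n′ q
  ... | yes eq = to-injective eq
  ... | no ¬eq = ⊥-elim (¬w (q , ¬eq))

module LowerBound (k : ℕ) where

  open Hard k
  open import Data.List.Membership.DecPropositional (Finₚ._≟_ {dim}) using (_∈?_)

  meets : Bool → List (Fin dim) → Fin k → Bool
  meets σ L i = does (x σ i ∈? L)

  x-injective : ∀ σ {i j} → x σ i ≡ x σ j → i ≡ j
  x-injective σ {i} {j} eq =
    Finₚ.suc-injective (Finₚ.suc-injective (combine-injectiveʳ (row σ) (suc (suc i)) (row σ) (suc (suc j)) eq))

  -- The keys x ρ (third (datum q) c) come after the data x (not ρ) (datum q).
  module Fooling {t : ℕ} (ρ : Bool) (c : Fin k) (L : List (Fin dim))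
    (datum : Fin t → Fin k) (datum-injective : ∀ {p q} → datum p ≡ datum q → p ≡ q)
    (datum∉ : ∀ q → x (not ρ) (datum q) ∉ L) (key∈ : ∀ q → x ρ (third (datum q) c) ∈ L)
    where

    key : Fin t → Fin k
    key q = third (datum q) c

    spread : (Fin t → Bool) → Fin k → Bool
    spread β j with any? (λ q → datum q Finₚ.≟ j)
    ... | yes (q , _) = β q
    ... | no  _       = false

    spread-datum : ∀ β q → spread β (datum q) ≡ β q
    spread-datum β q with any? (λ p → datum p Finₚ.≟ datum q)
    ... | yes (p , eq) = cong β (datum-injective eq)
    ... | no ¬w        = ⊥-elim (¬w (q , refl))

    spread-final : ∀ β β′ j → x (not ρ) j ∈ L → spread β j ≡ spread β′ j
    spread-final β β′ j j∈ with any? (λ p → datum p Finₚ.≟ j)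
    ... | yes (p , refl) = ⊥-elim (datum∉ p j∈)
    ... | no _           = refl

    -- `fool none β` supplies the prefix that stores `β` in the data; `fool (single (key q)) β` is
    -- its completion that asks for bit `q`.
    fool : (Fin k → Bool) → (Fin t → Bool) → Assignment dim
    fool p β = assign ρ (single c) (roles ρ p (spread β)) all

    hard-fool : ∀ β q → hard (fool (single (key q)) β) ≡ β q
    hard-fool β q = trans (hard-assign ρ c (key q) (spread β))
      (trans (cong (spread β) (third-inverse (datum q) c)) (spread-datum β q))

    module _ (C : Circuit dim) where

      -- The key is among the late variables, so switching it on does not touch the prefix.
      off : ∀ q β → AgreeOff C L (fool none β) (fool (single (key q)) β)
      off q β = assign-x-cong (_∉ L) λ σ i i∉ → roles-cong ρ {none} {single (key q)} {spread β} σ i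
        (λ { refl → sym (dec-false (key q Finₚ.≟ i) λ { refl → i∉ (key∈ q) }) }) (λ _ → refl)

      -- The stored bits are all read early, so the suffix is independent of them.
      on : ∀ q β β′ → AgreeOn C L (fool (single (key q)) β) (fool (single (key q)) β′)
      on q β β′ = assign-x-cong (_∈ L) λ σ i i∈ → roles-cong ρ {single (key q)} σ i
        (λ _ → refl) (λ { refl → spread-final β β′ i i∈ })

      bound : ∀ {cmp T} → Computes C hard → RightLinear T → Final L T → SDDAt C cmp T (output C) →
        2 ^ t ≤ suc (m C) + 2
      bound computes rl final sdd = fooling-set C L rl final sdd computes (fool none ∘ bits t) λ {n} {n′} n≢ →
        let q , differ = bits-differ t n≢ in
        fool (single (key q)) (bits t n) , fool (single (key q)) (bits t n′) ,
        off q (bits t n) , off q (bits t n′) , on q (bits t n) (bits t n′) ,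
        λ eq → differ (trans (sym (hard-fool (bits t n) q)) (trans eq (hard-fool (bits t n′) q)))

  module _ (t : ℕ) (k≡ : k ≡ 4 * t) (1≤k : 1 ≤ k) where

    crossing : Bool → List (Fin dim) → Fin k → Fin k → Bool
    crossing ρ L c j = not (meets (not ρ) L j) ∧ meets ρ L (third j c)

    -- Summed over all `c`, the pairs of an early datum and its late key number at least (2t)(2t) =
    -- k t, so some `c` has `t` of them.
    cut-bound : ∀ (C : Circuit dim) {cmp T} → Computes C hard → RightLinear T →
      SDDAt C cmp T (output C) → ∀ L → Final L T → ∀ ρ →
      2 * t ≤ count (meets ρ L) → 2 * t ≤ count (not ∘ meets (not ρ) L) → 2 ^ t ≤ suc (m C) + 2
    cut-bound C computes rl sdd L final ρ keys datas with average (count ∘ crossing ρ L) {t} 1≤k many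
      where
      square : ∀ t → 4 * t * t ≡ 2 * t * (2 * t)
      square = solve-∀
      many : k * t ≤ ∑ (count ∘ crossing ρ L)
      many = ≤-trans (≤-reflexive (trans (cong (_* t) k≡) (square t))) (≤-trans (ℕₚ.*-mono-≤ datas keys)
        (≤-reflexive (sym (count-thirds (not ∘ meets (not ρ) L) (meets ρ L)))))
    ... | c , t≤ with count-embed (crossing ρ L c) t≤
    ...   | datum , datum-injective , crosses = Fooling.bound ρ c L datum datum-injective
      (λ q → does-false (x (not ρ) (datum q) ∈? L) (proj₁ (∧-true (crosses q))))
      (λ q → does-true (x ρ (third (datum q) c) ∈? L)
        (proj₂ (∧-true {not (meets (not ρ) L (datum q))} (crosses q))))
      C computes rl final sdd

  module _ (C : Circuit dim) (computes : Computes C hard) {T} {cmp} (sdd : SDDAt C cmp T (output C)) where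

    -- A vtree may have fewer leaves than there are variables, but the cut needs the whole first
    -- block. The assignments `a₀` and `a₁` differ in this one variable: without a true key the
    -- value is true, while key `i` meets a false datum against a true `y`.
    occurs : ∀ i → x false i ∈ leaves T
    occurs i with x false i ∈? leaves T
    ... | yes i∈ = i∈
    ... | no i∉  = ⊥-elim (false≢true (trans (sym hard₁) (trans (sym
        (Val-functional C (SDDAt-local C sdd (λ v∈ → agree _ v∈) (computes a₀)) (computes a₁))) hard₀)))
      where
      a₀ a₁ : Assignment dim
      a₀ = assign false (single i) (λ _ → none) all
      a₁ = assign false (single i) (roles false (single i) none) all
      hard₀ : hard a₀ ≡ true
      hard₀ = trans (assign-hard false (single i) _ all refl) (assign-inner-none false (single i) _ all false i refl)
      hard₁ : hard a₁ ≡ false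
      hard₁ = hard-assign false i i none
      agree : ∀ v → v ∈ leaves T → a₀ v ≡ a₁ v
      agree = assign-x-cong (_∈ leaves T) λ
        { false j j∈ → sym (dec-false (i Finₚ.≟ j) λ { refl → i∉ j∈ })
        ; true  j _  → refl }

  meets-insert : ∀ v L → count (meets false (v ∷ L)) ≤ suc (count (meets false L))
  meets-insert v L = count-insert (meets false (v ∷ L)) (meets false L) (λ i → does (x false i Finₚ.≟ v))
    (λ i eq → case does-true (x false i ∈? v ∷ L) eq of λ
      { (here p)  → inj₁ (dec-true (x false i Finₚ.≟ v) p)
      ; (there p) → inj₂ (dec-true (x false i ∈? L) p) })
    (λ {i} {j} p q → x-injective false
      (trans (does-true (x false i Finₚ.≟ v) p) (sym (does-true (x false j Finₚ.≟ v) q))))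

  module _ (t : ℕ) (k≡ : k ≡ 4 * t) (1≤k : 1 ≤ k) where

    rest : ∀ (P : Fin k → Bool) → count P ≤ 2 * t → 2 * t ≤ count (not ∘ P)
    rest P le = ℕₚ.+-cancelˡ-≤ (2 * t) _ _ (≤-trans (≤-reflexive (trans (double t) (sym k≡))) (≤-trans
      (≤-reflexive (sym (count-complement P))) (ℕₚ.+-monoˡ-≤ (count (not ∘ P)) le)))
      where
      double : ∀ t → 2 * t + 2 * t ≡ 4 * t
      double = solve-∀

    exponential : ∀ C → IsOBDD C → Computes C hard → 2 ^ t ≤ suc (m C) + 2
    exponential C (T , vtree , rl , sdd) computes
      with final-part (count ∘ meets false) (count-none (meets false []) (λ _ → refl)) meets-insert rl vtree (2 * t)
        (subst (2 * t ≤_) (sym (trans (count-all (meets false (leaves T))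
          (λ i → dec-true (x false i ∈? leaves T) (occurs C computes sdd i))) k≡)) (ℕₚ.*-monoˡ-≤ t {2} {4} (s≤s (s≤s z≤n))))
    -- Exactly half of block `false` is late. If at least half of block `true` is late as well, its
    -- keys ask for the early half of block `false`; otherwise the late keys of block `false` ask
    -- for the early part of block `true`.
    ... | L , final , _ , half with 2 * t ≤? count (meets true L)
    ...   | yes le = cut-bound t k≡ 1≤k C computes rl sdd L final true le
      (rest (meets false L) (≤-reflexive half))
    ...   | no ¬le = cut-bound t k≡ 1≤k C computes rl sdd L final false (≤-reflexive (sym half))
      (rest (meets true L) (ℕₚ.<⇒≤ (ℕₚ.≰⇒> ¬le)))

-- Rewriting the lower bound in terms of the arity

^-distribʳ-* : ∀ a b n → (a * b) ^ n ≡ a ^ n * b ^ n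
^-distribʳ-* a b zero    = refl
^-distribʳ-* a b (suc n) = trans (cong (a * b *_) (^-distribʳ-* a b n)) (interchange a b (a ^ n) (b ^ n))
  where
  interchange : ∀ a b c d → a * b * (c * d) ≡ a * c * (b * d)
  interchange = solve-∀

module _ (t s : ℕ) (2≤t : 2 ≤ t) (2^t≤ : 2 ^ t ≤ suc s + 2) where

  1≤s : 1 ≤ s
  1≤s = ℕₚ.+-cancelʳ-≤ 3 1 s (≤-trans (ℕₚ.^-monoʳ-≤ 2 2≤t) (≤-trans 2^t≤ (≤-reflexive (sym (ℕₚ.+-suc s 2)))))

  -- The additive 3 stands for the sink and the two constant residues; it is at most 3s, because 4 ≤
  -- 2 ^ t already forces an arc.
  2^t≤4s : 2 ^ t ≤ 4 * s
  2^t≤4s = ≤-trans 2^t≤ (≤-trans (≤-reflexive (sym (ℕₚ.+-suc s 2))) (ℕₚ.+-monoʳ-≤ s (ℕₚ.*-monoʳ-≤ 3 1≤s)))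

  -- The exponent is 8 + 16t, so the left side is 2 ^ 8 times the 16th power of 2 ^ t, and 2 ^ t is
  -- at most 4s.
  power-bound : 2 ^ (4 * (2 + 4 * t)) ≤ 2 ^ 8 * 4 ^ 16 * s ^ 16
  power-bound = begin
    2 ^ (4 * (2 + 4 * t))      ≡⟨ cong (2 ^_) (split t) ⟩
    2 ^ (8 + t * 16)           ≡⟨ ℕₚ.^-distribˡ-+-* 2 8 (t * 16) ⟩
    2 ^ 8 * 2 ^ (t * 16)       ≡⟨ cong (2 ^ 8 *_) (sym (ℕₚ.^-*-assoc 2 t 16)) ⟩
    2 ^ 8 * (2 ^ t) ^ 16       ≤⟨ ℕₚ.*-monoʳ-≤ (2 ^ 8) (ℕₚ.^-monoˡ-≤ 16 2^t≤4s) ⟩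
    2 ^ 8 * (4 * s) ^ 16       ≡⟨ cong (2 ^ 8 *_) (^-distribʳ-* 4 s 16) ⟩
    2 ^ 8 * (4 ^ 16 * s ^ 16)  ≡⟨ sym (ℕₚ.*-assoc (2 ^ 8) (4 ^ 16) (s ^ 16)) ⟩
    2 ^ 8 * 4 ^ 16 * s ^ 16    ∎
    where
    open ℕₚ.≤-Reasoning
    split : ∀ t → 4 * (2 + 4 * t) ≡ 8 + t * 16
    split = solve-∀

-- Here k = 4t with t = 2 + r: divisible by 4 for the averaging, and t at least 2 so that an OBDD
-- has an arc.
data Family : (n : ℕ) → BoolFun n → Set where
  member : ∀ r → Family (Hard.dim (4 * (2 + r))) (Hard.hard (4 * (2 + r)))

-- The last clause is the lower bound 2 ^ Ω(n) without roots: the size is at least the `b`-th root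
-- of 2 ^ n / a, here with `b` = 16.
theorem4 : Σ ((n : ℕ) → BoolFun n → Set) λ F →
    ((k : ℕ) → ∃ λ n → k ≤ n × Σ (BoolFun n) λ f → F n f) ×
    (∃ λ c → ∃ λ n₀ → ∀ n (f : BoolFun n) → F n f → n₀ ≤ n →
    SDDcSize≤ f (c * n ^ 3)) ×
    (∃ λ a → ∃ λ b → ∃ λ n₀ → ∀ n (f : BoolFun n) → F n f → n₀ ≤ n →
    ∀ (C : Circuit n) → IsOBDD C → Computes C f →
    2 ^ n ≤ a * size C ^ b)
theorem4 = Family , unbounded , (1 , 0 , small) , (2 ^ 8 * 4 ^ 16 , 16 , 0 , large)
  where
  1≤4* : ∀ r → 1 ≤ 4 * (2 + r)
  1≤4* r = s≤s z≤n

  unbounded : (j : ℕ) → ∃ λ n → j ≤ n × Σ (BoolFun n) λ f → Family n f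
  unbounded j = _ , ≤-trans (ℕₚ.m≤n+m j 2) (≤-trans (ℕₚ.m≤n*m (2 + j) 4)
    (≤-trans (ℕₚ.m≤n+m (4 * (2 + j)) 2) (ℕₚ.m≤n*m (2 + 4 * (2 + j)) 4))) , _ , member j

  small : ∀ n (f : BoolFun n) → Family n f → 0 ≤ n → SDDcSize≤ f (1 * n ^ 3)
  small _ _ (member r) _ = Sdd⇒SDDcSize≤ hardTree-isVtree
    (weaken here (≤-trans hardSize≤ (≤-reflexive (sym (ℕₚ.*-identityˡ (dim ^ 3))))) (hardSdd (1≤4* r)))
    where open Hard (4 * (2 + r))

  large : ∀ n (f : BoolFun n) → Family n f → 0 ≤ n → ∀ (C : Circuit n) → IsOBDD C → Computes C f →
    2 ^ n ≤ 2 ^ 8 * 4 ^ 16 * size C ^ 16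
  large _ _ (member r) _ C obdd computes = power-bound (2 + r) (size C) (s≤s (s≤s z≤n))
    (≤-trans (LowerBound.exponential (4 * (2 + r)) (2 + r) refl (1≤4* r) C obdd computes)
      (ℕₚ.+-monoˡ-≤ 2 (s≤s (m≤size C))))
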